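{- Let $\delta\in(0,1)$. Suppose $\mu$ is the Gibbs distribution of a permissive spin system $(G,q,A_E,A_V)$, where $G$ has maximum degree $\Delta$, and $\mu$ satisfies the Dobrushin–Shlosman condition with gap $\delta$. Then $\mu$ satisfies $\frac{\Delta}{\delta}$-coupling independence.
   Context: A spin system $(G,q,A_E,A_V)$ on $G=(V,E)$ has Gibbs distribution $\mu(\sigma)\propto\prod_{\{u,v\}\in E}A_E(\sigma(u),\sigma(v))\prod_{v\in V}A_V(\sigma(v))$ for $\sigma\in[q]^V$, with $A_E\in\mathbb{R}_{\ge0}^{q\times q}$, $A_V\in\mathbb{R}_{\ge0}^q$. For $\Lambda\subseteq V$ and any (possibly infeasible) $\sigma\in[q]^\Lambda$, let $w^\sigma(\tau)=\mathbf 1[\tau|_\Lambda=\sigma]\prod_{v\notin\Lambda}A_V(\tau(v))\prod_{\{u,v\}\in E,u\notin\Lambda,v\in\Lambda}A_E(\tau(u),\sigma(v))\prod_{\{u,v\}\in E,u,v\notin\Lambda}A_E(\tau(u),\tau(v))$, $Z^\sigma=\sum_\tau w^\sigma(\tau)$, $\mu^\sigma=w^\sigma/Z^\sigma$. Permissive means $Z^\sigma>0$ for all $\Lambda,\sigma$. $\mu^\sigma_v$ is the marginal of $\mu^\sigma$ at $v$. The Dobrushin influence matrix is $\rho(u,v)=\max\{d_{TV}(\mu^\sigma_v,\mu^\tau_v):\sigma,\tau\in[q]^{V\setminus\{v\}}\text{ differing at most at }u\}$, and the Dobrushin–Shlosman condition with gap $\delta$ means $\max_{u}\sum_v\rho(u,v)\le1-\delta$.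 $C$-coupling independence: for every $\Lambda\subseteq V$ and $\sigma,\tau\in[q]^\Lambda$ differing at exactly one vertex, there is a coupling of $\mu^\sigma,\mu^\tau$ with expected Hamming distance at most $C$.
   Formalization: The maximum degree Δ is assumed to be at least 1, since for Δ = 0 (an edgeless graph with q ≥ 2) the bound Δ/δ = 0 fails: the pinned vertex of disagreement already contributes Hamming distance 1. -}

module Defs where

open import Level using (Level; 0ℓ; _⊔_) renaming (suc to lsuc)
open import Algebra.Bundles using (CommutativeRing)
import Algebra.Construct.NaturalChoice.Max as Max
import Algebra.Definitions.RawMonoid as RawMonoidOps
open import Data.Bool.Base using (if_then_else_; not)
open import Data.Fin.Base using (Fin)
import Data.Fin.Base as Fin
import Data.Fin.Properties as Fin
open import Data.Fin.Subset using (Subset; inside; outside; _∈_; _⊆_; ∁; ⁅_⁆; ∣_∣)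
open import Data.Fin.Subset.Properties using (_∈?_; _⊆?_)
open import Data.List.Base using (List; [_]; map; foldr; filter; length; allFin; cartesianProduct; cartesianProductWith)
import Data.List.Extrema as Extrema
import Data.List.Extrema.Nat as ExtremaNat
open import Data.Nat.Base using (ℕ; zero; suc)
open import Data.Product.Base using (_×_; _,_; ∃-syntax; uncurry)
open import Data.Vec.Base using (Vec; []; _∷_; lookup; here; there)
open import Relation.Binary.Bundles using (TotalOrder)
open import Relation.Binary.Core using (Rel)
open import Relation.Binary.Definitions using (Decidable; DecidableEquality; Symmetric)
open import Relation.Binary.Structures using (IsDecTotalOrder)
open import Relation.Binary.PropositionalEquality.Core using (_≡_; refl; cong; cong₂)
open import Relation.Nullary.Decidable using (Dec; yes; no; does; _×-dec_; ¬?; map′)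
open import Relation.Nullary.Negation using (¬_)

private
  variable
    p : Level
    n q : ℕ
    X : Set p
    Λ : Subset n

-- The real numbers enter only through their (classical) ordered-field
-- structure, with ≤ decidable.

record OrderedField c ℓ₁ ℓ₂ : Set (lsuc (c ⊔ ℓ₁ ⊔ ℓ₂)) where
  field
    commutativeRing : CommutativeRing c ℓ₁
  open CommutativeRing commutativeRing public hiding (refl)
  infix 4 _≤_ _<_
  infix 8 _⁻¹
  field
    _≤_             : Rel Carrier ℓ₂
    isDecTotalOrder : IsDecTotalOrder _≈_ _≤_
    +-monoˡ-≤       : ∀ {x y} z → x ≤ y → (x + z) ≤ (y + z)
    *-nonNeg        : ∀ {x y} → 0# ≤ x → 0# ≤ y → 0# ≤ (x * y)
    0≉1             : ¬ (0# ≈ 1#)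
    -- Total for convenience; nothing is said about 0# ⁻¹.
    _⁻¹             : Carrier → Carrier
    *-inverseʳ      : ∀ {x} → ¬ (x ≈ 0#) → (x * x ⁻¹) ≈ 1#

  _<_ : Rel Carrier (ℓ₁ ⊔ ℓ₂)
  x < y = x ≤ y × ¬ (x ≈ y)

  totalOrder : TotalOrder c ℓ₁ ℓ₂
  totalOrder = record
    { isTotalOrder = IsDecTotalOrder.isTotalOrder isDecTotalOrder }

  abs : Carrier → Carrier
  abs x = Max._⊔_ totalOrder x (- x)

  fromℕ : ℕ → Carrier
  fromℕ k = RawMonoidOps._×_ +-rawMonoid k 1#

  ∑ ∏ : List X → (X → Carrier) → Carrier
  ∑ xs f = foldr _+_ 0# (map f xs)
  ∏ xs f = foldr _*_ 1# (map f xs)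

  -- The maximum of f over xs, with 0# as the value for empty xs. It is only
  -- used for nonnegative f, where it is the ordinary maximum.
  maximum : List X → (X → Carrier) → Carrier
  maximum xs f = Extrema.max totalOrder 0# (map f xs)

  𝟙 : Dec X → Carrier
  𝟙 d = if does d then 1# else 0#

  -- The factor f when the condition holds, and the empty product otherwise.
  factor : Dec X → (X → Carrier) → Carrier
  factor (yes x) f = f x
  factor (no _)  f = 1#

-- Finite simple graphs with vertex set Fin n.

record Graph (n : ℕ) : Set₁ where
  field
    Adj    : Rel (Fin n) 0ℓ
    adj?   : Decidable Adj
    sym    : Symmetric Adj
    irrefl : ∀ {v} → ¬ Adj v v

  degree : Fin n → ℕ
  degree v = length (filter (adj? v) (allFin n))

  maxDegree : ℕ
  maxDegree = ExtremaNat.max 0 (map degree (allFin n))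

-- [q]^V

Config : ℕ → ℕ → Set
Config q n = Vec (Fin q) n

allConfigs : ∀ q n → List (Config q n)
allConfigs q zero    = [ [] ]
allConfigs q (suc n) = cartesianProductWith _∷_ (allFin q) (allConfigs q n)

hamming : Config q n → Config q n → ℕ
hamming {n = n} x y =
  length (filter (λ v → ¬? (lookup x v Fin.≟ lookup y v)) (allFin n))

-- [q]^Λ: one spin for each vertex of Λ, with free marking a vertex outside Λ.

data Assignment (q : ℕ) : Subset n → Set where
  []   : Assignment q []
  _∷_  : Fin q → Assignment q Λ → Assignment q (inside ∷ Λ)
  free : Assignment q Λ → Assignment q (outside ∷ Λ)

infixr 5 _∷_

at : ∀ {v : Fin n} → Assignment q Λ → v ∈ Λ → Fin q
at (c ∷ σ)  here        = c
at (c ∷ σ)  (there v∈Λ) = at σ v∈Λ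
at (free σ) (there v∈Λ) = at σ v∈Λ

restrict : (Λ : Subset n) → Config q n → Assignment q Λ
restrict []            []      = []
restrict (inside  ∷ Λ) (c ∷ τ) = c ∷ restrict Λ τ
restrict (outside ∷ Λ) (c ∷ τ) = free (restrict Λ τ)

_≟_ : DecidableEquality (Assignment q Λ)
[]       ≟ []       = yes refl
(c ∷ σ)  ≟ (d ∷ τ)  = map′ (uncurry (cong₂ _∷_)) (λ { refl → refl , refl })
                        ((c Fin.≟ d) ×-dec (σ ≟ τ))
(free σ) ≟ (free τ) = map′ (cong free) (λ { refl → refl }) (σ ≟ τ)

allAssignments : ∀ q (Λ : Subset n) → List (Assignment q Λ)
allAssignments q []            = [ [] ]
allAssignments q (inside  ∷ Λ) = cartesianProductWith _∷_ (allFin q) (allAssignments q Λ)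
allAssignments q (outside ∷ Λ) = map free (allAssignments q Λ)

disagreement : {Λ : Subset n} → Assignment q Λ → Assignment q Λ → Subset n
disagreement []       []       = []
disagreement (c ∷ σ)  (d ∷ τ)  = not (does (c Fin.≟ d)) ∷ disagreement σ τ
disagreement (free σ) (free τ) = outside ∷ disagreement σ τ

DifferAtExactlyOne : {Λ : Subset n} → Rel (Assignment q Λ) 0ℓ
DifferAtExactlyOne σ τ = ∣ disagreement σ τ ∣ ≡ 1

DifferAtMostAt : {Λ : Subset n} → Fin n → Rel (Assignment q Λ) 0ℓ
DifferAtMostAt u σ τ = disagreement σ τ ⊆ ⁅ u ⁆

differAtMostAt? : {Λ : Subset n} (u : Fin n) → Decidable (DifferAtMostAt {q = q} {Λ = Λ} u)
differAtMostAt? u σ τ = disagreement σ τ ⊆? ⁅ u ⁆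

module _ {c ℓ₁ ℓ₂} (F : OrderedField c ℓ₁ ℓ₂) where
  open OrderedField F

  record SpinSystem (n q : ℕ) : Set (lsuc 0ℓ ⊔ c ⊔ ℓ₁ ⊔ ℓ₂) where
    field
      graph      : Graph n
      A_E        : Fin q → Fin q → Carrier
      A_V        : Fin q → Carrier
      -- Needed for A_E(σ(u),σ(v)) to depend only on the unordered edge {u,v}.
      A_E-sym    : ∀ a b → A_E a b ≈ A_E b a
      A_E-nonNeg : ∀ a b → 0# ≤ A_E a b
      A_V-nonNeg : ∀ a → 0# ≤ A_V a

  IsCoupling : (Config q n → Config q n → Carrier) →
               (μ ν : Config q n → Carrier) → Set (ℓ₁ ⊔ ℓ₂)
  IsCoupling {q} {n} π μ ν =
    (∀ x y → 0# ≤ π x y) ×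
    (∀ x → ∑ (allConfigs q n) (λ y → π x y) ≈ μ x) ×
    (∀ y → ∑ (allConfigs q n) (λ x → π x y) ≈ ν y)

  expectedHamming : (Config q n → Config q n → Carrier) → Carrier
  expectedHamming {q} {n} π =
    ∑ (allConfigs q n) λ x → ∑ (allConfigs q n) λ y → π x y * fromℕ (hamming x y)

  dTV : (Fin q → Carrier) → (Fin q → Carrier) → Carrier
  dTV {q} μ ν = (1# + 1#) ⁻¹ * ∑ (allFin q) (λ a → abs (μ a - ν a))

  module _ {n q : ℕ} (S : SpinSystem n q) where
    open SpinSystem S
    open Graph graph

    private
      V : List (Fin n)
      V = allFin n

    -- An edge {u,v} with u ∉ Λ and v ∈ Λ occurs for one ordered pair (u , v);
    -- an edge inside V ∖ Λ is counted once by requiring u < v.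
    weight : {Λ : Subset n} → Assignment q Λ → Config q n → Carrier
    weight {Λ} σ τ =
      𝟙 (restrict Λ τ ≟ σ)
      * ∏ V (λ v → factor (¬? (v ∈? Λ)) λ _ → A_V (lookup τ v))
      * ∏ V (λ u → ∏ V λ v →
          factor (adj? u v ×-dec ¬? (u ∈? Λ) ×-dec (v ∈? Λ)) λ (_ , _ , v∈Λ) →
            A_E (lookup τ u) (at σ v∈Λ))
      * ∏ V (λ u → ∏ V λ v →
          factor ((u Fin.<? v) ×-dec adj? u v ×-dec ¬? (u ∈? Λ) ×-dec ¬? (v ∈? Λ)) λ _ →
            A_E (lookup τ u) (lookup τ v))

    Z : {Λ : Subset n} → Assignment q Λ → Carrier
    Z σ = ∑ (allConfigs q n) (weight σ)

    Permissive : Set (ℓ₁ ⊔ ℓ₂)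
    Permissive = ∀ (Λ : Subset n) (σ : Assignment q Λ) → 0# < Z σ

    -- The Gibbs distribution itself is the case Λ = ∅.
    μ : {Λ : Subset n} → Assignment q Λ → Config q n → Carrier
    μ σ τ = weight σ τ * Z σ ⁻¹

    marginal : {Λ : Subset n} → Assignment q Λ → Fin n → Fin q → Carrier
    marginal σ v a = ∑ (allConfigs q n) λ τ → 𝟙 (lookup τ v Fin.≟ a) * μ σ τ

    ρ : Fin n → Fin n → Carrier
    ρ u v = maximum
      (filter (λ (σ , τ) → differAtMostAt? u σ τ)
        (cartesianProduct (allAssignments q (∁ ⁅ v ⁆)) (allAssignments q (∁ ⁅ v ⁆))))
      λ (σ , τ) → dTV (marginal σ v) (marginal τ v)

    DobrushinShlosman : Carrier → Set ℓ₂
    DobrushinShlosman δ = maximum V (λ u → ∑ V (λ v → ρ u v)) ≤ 1# - δ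

    CouplingIndependent : Carrier → Set (c ⊔ ℓ₁ ⊔ ℓ₂)
    CouplingIndependent C =
      ∀ (Λ : Subset n) (σ τ : Assignment q Λ) → DifferAtExactlyOne σ τ →
      ∃[ π ] (IsCoupling π (μ σ) (μ τ) × expectedHamming π ≤ C)

{-# OPTIONS --safe #-}
module Submission where

-- For a coupling π of two conditional Gibbs distributions, let p(w) be the
-- probability that the two configurations disagree at w. We construct π with
--
--   p(w) ≤ ∑_u p(u) ρ(u,w)   for every free vertex w,                    (*)
--
-- by pinning the free vertices one at a time. Couple the spins at a free
-- vertex v optimally, and given the outcome (a,b) use the coupling obtained
-- inductively for the boundary conditions with v pinned to a and to b. At the
-- other free vertices (*) is linear in π, hence survives averaging. At v, p(v)
-- is the total variation distance of the marginals at v, and every coupling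
-- bounds that distance by ∑_u p(u) ρ(u,v): resample v given the rest, and
-- change the rest one vertex at a time.
-- No limit is involved, so this works over any ordered field. Summing (*) over
-- the free vertices, s = ∑_w p(w) satisfies s ≤ 1 + (1 − δ) s, so s ≤ 1/δ.

open import Algebra.Bundles using (CommutativeMonoid)
import Algebra.Construct.NaturalChoice.Max as Max
import Algebra.Construct.NaturalChoice.Min as Min
import Algebra.Properties.AbelianGroup as AbelianGroupProperties
import Algebra.Properties.CommutativeSemigroup as CommutativeSemigroupProperties
import Algebra.Properties.Ring as RingProperties
open import Data.Fin.Base using (Fin; zero; suc)
import Data.Fin.Base as Fin
import Data.Fin.Properties as Fin
open import Data.Fin.Subset using (Subset; inside; outside; _∈_; _∉_; _⊆_; ∁; ⁅_⁆; ∣_∣; _∪_)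
open import Data.Fin.Subset.Properties using (_∈?_; x∈⁅x⁆; x∈⁅y⁆⇒x≡y; x∈p∪q⁻; p⊆p∪q; q⊆p∪q; x∉p⇒x∈∁p)
open import Data.List.Base using (List; []; _∷_; map; foldr; filter; length; allFin; cartesianProduct)
import Data.List.Extrema as Extrema
open import Data.List.Membership.Propositional using () renaming (_∈_ to _∈ˡ_)
open import Data.List.Membership.Propositional.Properties using (∈-allFin; ∈-map⁺; ∈-cartesianProductWith⁺; ∈-cartesianProduct⁺; ∈-filter⁺)
open import Data.List.Properties using (map-tabulate)
import Data.List.Relation.Unary.All as All
open import Data.List.Relation.Unary.Any using (here; there)
open import Data.Nat.Base using (ℕ; zero; suc)
import Data.Nat.Base as ℕ
open import Data.Product.Base using (_×_; _,_; proj₁; proj₂; ∃-syntax)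
open import Data.Sum.Base using (_⊎_; inj₁; inj₂; [_,_]′)
open import Data.Vec.Base using ([]; _∷_; lookup; _[_]≔_; here; there)
open import Data.Vec.Properties using (lookup∘update; lookup∘update′)
open import Function.Base using (_∘_; id)
open import Level using (Level)
open import Relation.Binary.Bundles using (Poset)
open import Relation.Binary.Definitions using (tri<; tri≈; tri>)
open import Relation.Binary.PropositionalEquality.Core using (_≡_; _≢_; refl; cong; cong₂; subst)
import Relation.Binary.PropositionalEquality.Core as ≡
import Relation.Binary.Reasoning.PartialOrder as PosetReasoning
import Relation.Binary.Reasoning.Setoid as SetoidReasoning
open import Relation.Binary.Structures using (IsDecTotalOrder)
open import Relation.Nullary.Decidable using (Dec; yes; no; ¬?; _×-dec_; decidable-stable; toSum)
open import Relation.Nullary.Negation using (¬_; contradiction)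

open import Defs

private
  variable
    p p′ : Level
    X : Set p
    Y : Set p′

-- Finite folds in a commutative monoid

module BigOperator {c ℓ : Level} (M : CommutativeMonoid c ℓ) where
  open CommutativeMonoid M renaming (refl to ≈-refl)
  open CommutativeSemigroupProperties commutativeSemigroup using (interchange)

  -- At the additive and the multiplicative monoid of the field this unfolds to `∑` and to `∏`, so
  -- the lemmas below serve both.
  fold : List X → (X → Carrier) → Carrier
  fold xs f = foldr _∙_ ε (map f xs)

  fold-cong : (xs : List X) {f g : X → Carrier} → (∀ x → f x ≈ g x) → fold xs f ≈ fold xs g
  fold-cong []       f≈g = ≈-refl
  fold-cong (x ∷ xs) f≈g = ∙-cong (f≈g x) (fold-cong xs f≈g)

  fold-ε : (xs : List X) → fold xs (λ _ → ε) ≈ ε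
  fold-ε []       = ≈-refl
  fold-ε (x ∷ xs) = trans (identityˡ _) (fold-ε xs)

  fold-∙ : (xs : List X) (f g : X → Carrier) →
           fold xs (λ x → f x ∙ g x) ≈ fold xs f ∙ fold xs g
  fold-∙ []       f g = sym (identityˡ ε)
  fold-∙ (x ∷ xs) f g = trans (∙-congˡ (fold-∙ xs f g)) (interchange _ _ _ _)

  fold-swap : (xs : List X) (ys : List Y) (f : X → Y → Carrier) →
              fold xs (λ x → fold ys (f x)) ≈ fold ys (λ y → fold xs (λ x → f x y))
  fold-swap []       ys f = sym (fold-ε ys)
  fold-swap (x ∷ xs) ys f = trans (∙-congˡ (fold-swap xs ys f)) (sym (fold-∙ ys (f x) _))

  fold-map : (h : X → Y) (xs : List X) (f : Y → Carrier) → fold (map h xs) f ≈ fold xs (f ∘ h)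
  fold-map h []       f = ≈-refl
  fold-map h (x ∷ xs) f = ∙-congˡ (fold-map h xs f)

  fold-allFin-suc : ∀ n (f : Fin (suc n) → Carrier) →
                    fold (allFin (suc n)) f ≈ f zero ∙ fold (allFin n) (f ∘ suc)
  fold-allFin-suc n f = ∙-congˡ (trans
    (reflexive (cong (λ xs → fold xs f) (≡.sym (map-tabulate id suc))))
    (fold-map suc (allFin n) f))

-- Arithmetic of ordered fields

module OrderedFieldProperties {c ℓ₁ ℓ₂ : Level} (F : OrderedField c ℓ₁ ℓ₂) where
  open OrderedField F hiding (zero)

  ≈-refl : ∀ {x} → x ≈ x
  ≈-refl = reflexive refl

  open IsDecTotalOrder isDecTotalOrder public
    using (total; antisym; isPartialOrder)
    renaming (refl to ≤-refl; reflexive to ≤-reflexive; trans to ≤-trans; _≟_ to _≈?_)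
  open RingProperties ring using (-‿distribʳ-*; -‿distribˡ-*; x[y-z]≈xy-xz; -0#≈0#)
  open AbelianGroupProperties +-abelianGroup using ()
    renaming (⁻¹-∙-comm to -‿+-comm; ⁻¹-involutive to -‿involutive)

  ≤-poset : Poset c ℓ₁ ℓ₂
  ≤-poset = record { isPartialOrder = isPartialOrder }

  module ≈-Reasoning = SetoidReasoning setoid
  module ≤-Reasoning = PosetReasoning ≤-poset

  private
    module ∑ᵐ = BigOperator +-commutativeMonoid
    module ∏ᵐ = BigOperator *-commutativeMonoid

  +-monoʳ-≤ : ∀ {x y} z → x ≤ y → z + x ≤ z + y
  +-monoʳ-≤ {x} {y} z x≤y = begin
    z + x  ≈⟨ +-comm z x ⟩
    x + z  ≤⟨ +-monoˡ-≤ z x≤y ⟩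
    y + z  ≈⟨ +-comm y z ⟩
    z + y  ∎
    where open ≤-Reasoning

  +-mono-≤ : ∀ {x y u v} → x ≤ y → u ≤ v → x + u ≤ y + v
  +-mono-≤ x≤y u≤v = ≤-trans (+-monoˡ-≤ _ x≤y) (+-monoʳ-≤ _ u≤v)

  +-nonNeg : ∀ {x y} → 0# ≤ x → 0# ≤ y → 0# ≤ x + y
  +-nonNeg 0≤x 0≤y = ≤-trans (≤-reflexive (sym (+-identityˡ 0#))) (+-mono-≤ 0≤x 0≤y)

  x≤x+y : ∀ {x y} → 0# ≤ y → x ≤ x + y
  x≤x+y 0≤y = ≤-trans (≤-reflexive (sym (+-identityʳ _))) (+-monoʳ-≤ _ 0≤y)

  y≤x+y : ∀ {x y} → 0# ≤ x → y ≤ x + y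
  y≤x+y 0≤x = ≤-trans (≤-reflexive (sym (+-identityˡ _))) (+-monoˡ-≤ _ 0≤x)

  x-y+y≈x : ∀ x y → x - y + y ≈ x
  x-y+y≈x x y = begin
    x - y + y      ≈⟨ +-assoc x (- y) y ⟩
    x + (- y + y)  ≈⟨ +-congˡ (-‿inverseˡ y) ⟩
    x + 0#         ≈⟨ +-identityʳ x ⟩
    x              ∎
    where open ≈-Reasoning

  y+[x-y]≈x : ∀ x y → y + (x - y) ≈ x
  y+[x-y]≈x x y = trans (+-comm y _) (x-y+y≈x x y)

  x≤y⇒0≤y-x : ∀ {x y} → x ≤ y → 0# ≤ y - x
  x≤y⇒0≤y-x {x} x≤y = ≤-trans (≤-reflexive (sym (-‿inverseʳ x))) (+-monoˡ-≤ (- x) x≤y)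

  0≤y-x⇒x≤y : ∀ {x y} → 0# ≤ y - x → x ≤ y
  0≤y-x⇒x≤y {x} {y} 0≤y-x = begin
    x          ≤⟨ y≤x+y 0≤y-x ⟩
    y - x + x  ≈⟨ x-y+y≈x y x ⟩
    y          ∎
    where open ≤-Reasoning

  *-monoʳ-≤ : ∀ {x y z} → 0# ≤ z → x ≤ y → z * x ≤ z * y
  *-monoʳ-≤ {x} {y} {z} 0≤z x≤y = 0≤y-x⇒x≤y (≤-trans
    (*-nonNeg 0≤z (x≤y⇒0≤y-x x≤y))
    (≤-reflexive (x[y-z]≈xy-xz z y x)))

  *-monoˡ-≤ : ∀ {x y z} → 0# ≤ z → x ≤ y → x * z ≤ y * z
  *-monoˡ-≤ {x} {y} {z} 0≤z x≤y = begin
    x * z  ≈⟨ *-comm x z ⟩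
    z * x  ≤⟨ *-monoʳ-≤ 0≤z x≤y ⟩
    z * y  ≈⟨ *-comm z y ⟩
    y * z  ∎
    where open ≤-Reasoning

  x≤0⇒0≤-x : ∀ {x} → x ≤ 0# → 0# ≤ - x
  x≤0⇒0≤-x x≤0 = ≤-trans (x≤y⇒0≤y-x x≤0) (≤-reflexive (+-identityˡ _))

  -‿*-‿ : ∀ x y → - x * - y ≈ x * y
  -‿*-‿ x y = begin
    - x * - y    ≈⟨ -‿distribˡ-* x (- y) ⟨
    - (x * - y)  ≈⟨ -‿cong (-‿distribʳ-* x y) ⟨
    - - (x * y)  ≈⟨ -‿involutive (x * y) ⟩
    x * y        ∎
    where open ≈-Reasoning

  -- If instead 1 ≤ 0, then 0 ≤ -1, and squaring gives 0 ≤ (-1)(-1) = 1 after all.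
  0≤1 : 0# ≤ 1#
  0≤1 with total 0# 1#
  ... | inj₁ 0≤1 = 0≤1
  ... | inj₂ 1≤0 = ≤-trans (*-nonNeg (x≤0⇒0≤-x 1≤0) (x≤0⇒0≤-x 1≤0))
                     (≤-reflexive (trans (-‿*-‿ 1# 1#) (*-identityʳ 1#)))

  -- If `x ⁻¹` were nonpositive, `x * - (x ⁻¹)`, which equals -1, would be nonnegative; then 1 ≤ 0
  -- and so 0 = 1.
  ⁻¹-nonNeg : ∀ {x} → 0# < x → 0# ≤ x ⁻¹
  ⁻¹-nonNeg {x} (0≤x , 0≉x) with total 0# (x ⁻¹)
  ... | inj₁ 0≤x⁻¹ = 0≤x⁻¹
  ... | inj₂ x⁻¹≤0 = contradiction (antisym 0≤1 1≤0) 0≉1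
    where
    0≤-1 : 0# ≤ 0# - 1#
    0≤-1 = begin
      0#              ≤⟨ *-nonNeg 0≤x (x≤0⇒0≤-x x⁻¹≤0) ⟩
      x * - (x ⁻¹)    ≈⟨ -‿distribʳ-* x (x ⁻¹) ⟨
      - (x * x ⁻¹)    ≈⟨ -‿cong (*-inverseʳ (0≉x ∘ sym)) ⟩
      - 1#            ≈⟨ +-identityˡ (- 1#) ⟨
      0# - 1#         ∎
      where open ≤-Reasoning
    1≤0 : 1# ≤ 0#
    1≤0 = 0≤y-x⇒x≤y 0≤-1

  2≉0 : ¬ (1# + 1# ≈ 0#)
  2≉0 2≈0 = 0≉1 (antisym 0≤1 (≤-trans (x≤x+y 0≤1) (≤-reflexive 2≈0)))

  0<2 : 0# < 1# + 1#
  0<2 = +-nonNeg 0≤1 0≤1 , 2≉0 ∘ sym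

  -- Absolute values

  private
    module ⊔ = Max totalOrder
    module ⊓ = Min totalOrder

  x≤abs : ∀ x → x ≤ abs x
  x≤abs x = ⊔.x≤x⊔y x (- x)

  -x≤abs : ∀ x → - x ≤ abs x
  -x≤abs x = ⊔.x≤y⊔x x (- x)

  abs-least : ∀ {x z} → x ≤ z → - x ≤ z → abs x ≤ z
  abs-least = ⊔.⊔-lub

  abs-cong : ∀ {x y} → x ≈ y → abs x ≈ abs y
  abs-cong x≈y = ⊔.⊔-cong x≈y (-‿cong x≈y)

  abs-0 : abs 0# ≈ 0#
  abs-0 = trans (⊔.⊔-cong ≈-refl -0#≈0#) (⊔.⊔-idem 0#)

  abs-+ : ∀ x y → abs (x + y) ≤ abs x + abs y
  abs-+ x y = abs-least
    (+-mono-≤ (x≤abs x) (x≤abs y))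
    (≤-trans (≤-reflexive (sym (-‿+-comm x y))) (+-mono-≤ (-x≤abs x) (-x≤abs y)))

  abs-* : ∀ {k} x → 0# ≤ k → abs (k * x) ≤ k * abs x
  abs-* {k} x 0≤k = abs-least
    (*-monoʳ-≤ 0≤k (x≤abs x))
    (≤-trans (≤-reflexive (-‿distribʳ-* k x)) (*-monoʳ-≤ 0≤k (-x≤abs x)))

  infixl 7 _⊓_
  _⊓_ : Carrier → Carrier → Carrier
  _⊓_ = ⊓._⊓_

  x⊓y≤x : ∀ x y → x ⊓ y ≤ x
  x⊓y≤x = ⊓.x⊓y≤x

  x⊓y≤y : ∀ x y → x ⊓ y ≤ y
  x⊓y≤y = ⊓.x⊓y≤y

  ⊓-nonNeg : ∀ {x y} → 0# ≤ x → 0# ≤ y → 0# ≤ x ⊓ y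
  ⊓-nonNeg = ⊓.⊓-glb

  private
    abs-of-nonPos : ∀ {x} → x ≤ 0# → abs x ≈ - x
    abs-of-nonPos x≤0 = ⊔.x≤y⇒x⊔y≈y (≤-trans x≤0 (x≤0⇒0≤-x x≤0))

    -[x-y]≈y-x : ∀ x y → - (x - y) ≈ y - x
    -[x-y]≈y-x x y = trans (sym (-‿+-comm x (- y)))
      (trans (+-congˡ (-‿involutive y)) (+-comm (- x) y))

    x-y≤0 : ∀ {x y} → x ≤ y → x - y ≤ 0#
    x-y≤0 {x} {y} x≤y = ≤-trans (+-monoˡ-≤ (- y) x≤y) (≤-reflexive (-‿inverseʳ y))

    abs-sub-comm : ∀ x y → abs (x - y) ≈ abs (y - x)
    abs-sub-comm x y = begin
      abs (x - y)                     ≡⟨⟩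
      (x - y) ⊔.⊔ - (x - y)           ≈⟨ ⊔.⊔-comm _ _ ⟩
      - (x - y) ⊔.⊔ (x - y)           ≈⟨ ⊔.⊔-cong (-[x-y]≈y-x x y) (sym (-[x-y]≈y-x y x)) ⟩
      abs (y - x)                     ∎
      where open ≈-Reasoning

    abs-sub-≤ : ∀ {x y} → x ≤ y → abs (x - y) ≈ (x - x ⊓ y) + (y - x ⊓ y)
    abs-sub-≤ {x} {y} x≤y = begin
      abs (x - y)                ≈⟨ abs-of-nonPos (x-y≤0 x≤y) ⟩
      - (x - y)                  ≈⟨ -[x-y]≈y-x x y ⟩
      y - x                      ≈⟨ +-congˡ (-‿cong x⊓y≈x) ⟨
      y - x ⊓ y                  ≈⟨ +-identityˡ _ ⟨
      0# + (y - x ⊓ y)           ≈⟨ +-congʳ (-‿inverseʳ x) ⟨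
      (x - x) + (y - x ⊓ y)      ≈⟨ +-congʳ (+-congˡ (-‿cong x⊓y≈x)) ⟨
      (x - x ⊓ y) + (y - x ⊓ y)  ∎
      where
      open ≈-Reasoning
      x⊓y≈x : x ⊓ y ≈ x
      x⊓y≈x = ⊓.x≤y⇒x⊓y≈x x≤y

  -- For `x ≤ y` the first excess over the minimum is zero and the second is `y - x`; the other case
  -- is symmetric. Summed over spins, this links total variation to the coupling that keeps the
  -- common mass together.
  abs-sub : ∀ x y → abs (x - y) ≈ (x - x ⊓ y) + (y - x ⊓ y)
  abs-sub x y = [ abs-sub-≤ , flipped ]′ (total x y)
    where
    open ≈-Reasoning
    flipped : y ≤ x → abs (x - y) ≈ (x - x ⊓ y) + (y - x ⊓ y)
    flipped y≤x = begin
      abs (x - y)                ≈⟨ abs-sub-comm x y ⟩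
      abs (y - x)                ≈⟨ abs-sub-≤ y≤x ⟩
      (y - y ⊓ x) + (x - y ⊓ x)  ≈⟨ +-comm _ _ ⟩
      (x - y ⊓ x) + (y - y ⊓ x)  ≈⟨ +-cong (+-congˡ (-‿cong (⊓.⊓-comm y x)))
                                           (+-congˡ (-‿cong (⊓.⊓-comm y x))) ⟩
      (x - x ⊓ y) + (y - x ⊓ y)  ∎

  -- Indicators

  𝟙-true : {A : Set p} (d : Dec A) → A → 𝟙 d ≈ 1#
  𝟙-true (yes _) _ = ≈-refl
  𝟙-true (no ¬a) a = contradiction a ¬a

  𝟙-false : {A : Set p} (d : Dec A) → ¬ A → 𝟙 d ≈ 0#
  𝟙-false (yes a) ¬a = contradiction a ¬a
  𝟙-false (no _)  _  = ≈-refl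

  𝟙-nonNeg : {A : Set p} (d : Dec A) → 0# ≤ 𝟙 d
  𝟙-nonNeg (yes _) = 0≤1
  𝟙-nonNeg (no _)  = ≤-refl

  𝟙-mono : {A : Set p} {B : Set p′} (d : Dec A) (e : Dec B) → (A → B) → 𝟙 d ≤ 𝟙 e
  𝟙-mono (no _)  e f = 𝟙-nonNeg e
  𝟙-mono (yes a) e f = ≤-reflexive (sym (𝟙-true e (f a)))

  𝟙-cong : {A : Set p} {B : Set p′} (d : Dec A) (e : Dec B) → (A → B) → (B → A) → 𝟙 d ≈ 𝟙 e
  𝟙-cong d e f g = antisym (𝟙-mono d e f) (𝟙-mono e d g)

  -- Finite sums and products

  ∑-cong : (xs : List X) {f g : X → Carrier} → (∀ x → f x ≈ g x) → ∑ xs f ≈ ∑ xs g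
  ∑-cong = ∑ᵐ.fold-cong

  ∑-+ : (xs : List X) (f g : X → Carrier) → ∑ xs (λ x → f x + g x) ≈ ∑ xs f + ∑ xs g
  ∑-+ = ∑ᵐ.fold-∙

  ∑-0 : (xs : List X) → ∑ xs (λ _ → 0#) ≈ 0#
  ∑-0 = ∑ᵐ.fold-ε

  ∑-swap : (xs : List X) (ys : List Y) (f : X → Y → Carrier) →
           ∑ xs (λ x → ∑ ys (f x)) ≈ ∑ ys (λ y → ∑ xs (λ x → f x y))
  ∑-swap = ∑ᵐ.fold-swap

  ∑-allFin-suc : ∀ n (f : Fin (suc n) → Carrier) →
                 ∑ (allFin (suc n)) f ≈ f zero + ∑ (allFin n) (f ∘ suc)
  ∑-allFin-suc = ∑ᵐ.fold-allFin-suc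

  ∏-cong : (xs : List X) {f g : X → Carrier} → (∀ x → f x ≈ g x) → ∏ xs f ≈ ∏ xs g
  ∏-cong = ∏ᵐ.fold-cong

  ∏-* : (xs : List X) (f g : X → Carrier) → ∏ xs (λ x → f x * g x) ≈ ∏ xs f * ∏ xs g
  ∏-* = ∏ᵐ.fold-∙

  ∏-swap : (xs : List X) (ys : List Y) (f : X → Y → Carrier) →
           ∏ xs (λ x → ∏ ys (f x)) ≈ ∏ ys (λ y → ∏ xs (λ x → f x y))
  ∏-swap = ∏ᵐ.fold-swap

  ∏-nonNeg : (xs : List X) {f : X → Carrier} → (∀ x → 0# ≤ f x) → 0# ≤ ∏ xs f
  ∏-nonNeg []       0≤f = 0≤1
  ∏-nonNeg (x ∷ xs) 0≤f = *-nonNeg (0≤f x) (∏-nonNeg xs 0≤f)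

  ∑-mono-≤ : (xs : List X) {f g : X → Carrier} → (∀ x → f x ≤ g x) → ∑ xs f ≤ ∑ xs g
  ∑-mono-≤ []       f≤g = ≤-refl
  ∑-mono-≤ (x ∷ xs) f≤g = +-mono-≤ (f≤g x) (∑-mono-≤ xs f≤g)

  ∑-nonNeg : (xs : List X) {f : X → Carrier} → (∀ x → 0# ≤ f x) → 0# ≤ ∑ xs f
  ∑-nonNeg []       0≤f = ≤-refl
  ∑-nonNeg (x ∷ xs) 0≤f = +-nonNeg (0≤f x) (∑-nonNeg xs 0≤f)

  ∑-*ˡ : (xs : List X) (k : Carrier) (f : X → Carrier) → ∑ xs (λ x → k * f x) ≈ k * ∑ xs f
  ∑-*ˡ []       k f = sym (zeroʳ k)
  ∑-*ˡ (x ∷ xs) k f = trans (+-congˡ (∑-*ˡ xs k f)) (sym (distribˡ k _ _))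

  ∑-*ʳ : (xs : List X) (k : Carrier) (f : X → Carrier) → ∑ xs (λ x → f x * k) ≈ ∑ xs f * k
  ∑-*ʳ xs k f = begin
    ∑ xs (λ x → f x * k)  ≈⟨ ∑-cong xs (λ x → *-comm (f x) k) ⟩
    ∑ xs (λ x → k * f x)  ≈⟨ ∑-*ˡ xs k f ⟩
    k * ∑ xs f            ≈⟨ *-comm k _ ⟩
    ∑ xs f * k            ∎
    where open ≈-Reasoning

  ∑-neg : (xs : List X) (f : X → Carrier) → ∑ xs (λ x → - f x) ≈ - ∑ xs f
  ∑-neg []       f = sym -0#≈0#
  ∑-neg (x ∷ xs) f = trans (+-congˡ (∑-neg xs f)) (-‿+-comm _ _)

  ∑-sub : (xs : List X) (f g : X → Carrier) → ∑ xs (λ x → f x - g x) ≈ ∑ xs f - ∑ xs g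
  ∑-sub xs f g = trans (∑-+ xs f (λ x → - g x)) (+-congˡ (∑-neg xs g))

  term≤∑ : {xs : List X} {f : X → Carrier} → (∀ x → 0# ≤ f x) → ∀ {x} → x ∈ˡ xs → f x ≤ ∑ xs f
  term≤∑ {xs = _ ∷ xs} 0≤f (here refl)  = x≤x+y (∑-nonNeg xs 0≤f)
  term≤∑ {xs = _ ∷ xs} 0≤f (there x∈xs) = ≤-trans (term≤∑ 0≤f x∈xs) (y≤x+y (0≤f _))

  ∑≈0⇒term≈0 : {xs : List X} {f : X → Carrier} → (∀ x → 0# ≤ f x) → ∑ xs f ≈ 0# →
               ∀ {x} → x ∈ˡ xs → f x ≈ 0#
  ∑≈0⇒term≈0 0≤f ∑≈0 x∈xs = antisym (≤-trans (term≤∑ 0≤f x∈xs) (≤-reflexive ∑≈0)) (0≤f _)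

  abs-∑ : (xs : List X) (f : X → Carrier) → abs (∑ xs f) ≤ ∑ xs (λ x → abs (f x))
  abs-∑ []       f = ≤-reflexive abs-0
  abs-∑ (x ∷ xs) f = ≤-trans (abs-+ _ _) (+-monoʳ-≤ _ (abs-∑ xs f))

  ∑-𝟙 : ∀ {n} (i : Fin n) (f : Fin n → Carrier) → ∑ (allFin n) (λ j → 𝟙 (i Fin.≟ j) * f j) ≈ f i
  ∑-𝟙 {suc n} zero f = begin
    ∑ (allFin (suc n)) (λ j → 𝟙 (zero Fin.≟ j) * f j)    ≈⟨ ∑-allFin-suc n _ ⟩
    1# * f zero + ∑ (allFin n) (λ j → 0# * f (suc j))    ≈⟨ +-cong (*-identityˡ _) (∑-cong (allFin n) (λ j → zeroˡ _)) ⟩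
    f zero + ∑ (allFin n) (λ j → 0#)                     ≈⟨ +-congˡ (∑-0 (allFin n)) ⟩
    f zero + 0#                                          ≈⟨ +-identityʳ _ ⟩
    f zero                                               ∎
    where open ≈-Reasoning
  ∑-𝟙 {suc n} (suc i) f = begin
    ∑ (allFin (suc n)) (λ j → 𝟙 (suc i Fin.≟ j) * f j)                   ≈⟨ ∑-allFin-suc n _ ⟩
    0# * f zero + ∑ (allFin n) (λ j → 𝟙 (suc i Fin.≟ suc j) * f (suc j)) ≈⟨ +-congʳ (zeroˡ _) ⟩
    0# + ∑ (allFin n) (λ j → 𝟙 (i Fin.≟ j) * f (suc j))                  ≈⟨ +-identityˡ _ ⟩
    ∑ (allFin n) (λ j → 𝟙 (i Fin.≟ j) * f (suc j))                       ≈⟨ ∑-𝟙 i (f ∘ suc) ⟩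
    f (suc i)                                                            ∎
    where open ≈-Reasoning

  -- Turns the Hamming distance, the length of a filtered list, into a sum of indicators to which
  -- linearity applies.
  fromℕ-length-filter : {P : X → Set p} (P? : ∀ x → Dec (P x)) (xs : List X) →
                        fromℕ (length (filter P? xs)) ≈ ∑ xs (λ x → 𝟙 (P? x))
  fromℕ-length-filter P? [] = ≈-refl
  fromℕ-length-filter P? (x ∷ xs) with P? x
  ... | yes _ = +-congˡ (fromℕ-length-filter P? xs)
  ... | no _  = trans (fromℕ-length-filter P? xs) (sym (+-identityˡ _))

  fromℕ-nonNeg : ∀ k → 0# ≤ fromℕ k
  fromℕ-nonNeg zero    = ≤-refl
  fromℕ-nonNeg (suc k) = +-nonNeg 0≤1 (fromℕ-nonNeg k)

  1≤fromℕ : ∀ {k} → 1 ℕ.≤ k → 1# ≤ fromℕ k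
  1≤fromℕ {suc k} _ = x≤x+y (fromℕ-nonNeg k)

  maximum-nonNeg : (xs : List X) (f : X → Carrier) → 0# ≤ maximum xs f
  maximum-nonNeg xs f = Extrema.⊥≤max totalOrder 0# (map f xs)

  term≤maximum : {xs : List X} (f : X → Carrier) → ∀ {x} → x ∈ˡ xs → f x ≤ maximum xs f
  term≤maximum {xs = xs} f x∈xs = All.lookup (Extrema.xs≤max totalOrder 0# (map f xs)) (∈-map⁺ f x∈xs)

-- Couplings and expectations over finite lists

module CouplingProperties {c ℓ₁ ℓ₂ : Level} (F : OrderedField c ℓ₁ ℓ₂) where
  open OrderedField F hiding (zero)
  open OrderedFieldProperties F
  open RingProperties ring using (-‿distribʳ-*)

  private
    variable
      a a′ : Level
      A : Set a
      B : Set a′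

  -- Indexing by lists lets the same lemmas treat pairs of spins and pairs of configurations. On
  -- `allConfigs q n`, `expect` unfolds to the double sum in `expectedHamming` and `Couples` to
  -- `IsCoupling`.
  expect : List X → List Y → (X → Y → Carrier) → (X → Y → Carrier) → Carrier
  expect xs ys π f = ∑ xs λ x → ∑ ys λ y → π x y * f x y

  Couples : List X → List Y → (X → Y → Carrier) → (X → Carrier) → (Y → Carrier) → Set _
  Couples xs ys π μ ν =
    (∀ x y → 0# ≤ π x y) ×
    (∀ x → ∑ ys (λ y → π x y) ≈ μ x) ×
    (∀ y → ∑ xs (λ x → π x y) ≈ ν y)

  module _ (xs : List X) (ys : List Y) {π : X → Y → Carrier} where

    expect-cong : {f g : X → Y → Carrier} → (∀ x y → π x y * f x y ≈ π x y * g x y) →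
                  expect xs ys π f ≈ expect xs ys π g
    expect-cong f≈g = ∑-cong xs λ x → ∑-cong ys λ y → f≈g x y

    expect-mono-≤ : {f g : X → Y → Carrier} → (∀ x y → π x y * f x y ≤ π x y * g x y) →
                    expect xs ys π f ≤ expect xs ys π g
    expect-mono-≤ f≤g = ∑-mono-≤ xs λ x → ∑-mono-≤ ys λ y → f≤g x y

    expect-nonNeg : {f : X → Y → Carrier} → (∀ x y → 0# ≤ π x y) → (∀ x y → 0# ≤ f x y) →
                    0# ≤ expect xs ys π f
    expect-nonNeg 0≤π 0≤f = ∑-nonNeg xs λ x → ∑-nonNeg ys λ y → *-nonNeg (0≤π x y) (0≤f x y)

    expect-*ʳ : (f : X → Y → Carrier) (k : Carrier) →
                expect xs ys π (λ x y → f x y * k) ≈ expect xs ys π f * k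
    expect-*ʳ f k = begin
      ∑ xs (λ x → ∑ ys λ y → π x y * (f x y * k))  ≈⟨ (∑-cong xs λ x → ∑-cong ys λ y → sym (*-assoc _ _ _)) ⟩
      ∑ xs (λ x → ∑ ys λ y → π x y * f x y * k)    ≈⟨ (∑-cong xs λ x → ∑-*ʳ ys k _) ⟩
      ∑ xs (λ x → (∑ ys λ y → π x y * f x y) * k)  ≈⟨ ∑-*ʳ xs k _ ⟩
      expect xs ys π f * k                         ∎
      where open ≈-Reasoning

    expect-*ˡ : (k : Carrier) (f : X → Y → Carrier) →
                expect xs ys π (λ x y → k * f x y) ≈ k * expect xs ys π f
    expect-*ˡ k f = begin
      expect xs ys π (λ x y → k * f x y)  ≈⟨ expect-cong (λ x y → *-congˡ (*-comm k _)) ⟩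
      expect xs ys π (λ x y → f x y * k)  ≈⟨ expect-*ʳ f k ⟩
      expect xs ys π f * k                ≈⟨ *-comm _ k ⟩
      k * expect xs ys π f                ∎
      where open ≈-Reasoning

    expect-sub : (f g : X → Y → Carrier) →
                 expect xs ys π (λ x y → f x y - g x y) ≈ expect xs ys π f - expect xs ys π g
    expect-sub f g = begin
      ∑ xs (λ x → ∑ ys λ y → π x y * (f x y - g x y))
        ≈⟨ (∑-cong xs λ x → ∑-cong ys λ y → trans (distribˡ _ _ _) (+-congˡ (sym (-‿distribʳ-* _ _)))) ⟩
      ∑ xs (λ x → ∑ ys λ y → π x y * f x y - π x y * g x y)
        ≈⟨ (∑-cong xs λ x → ∑-sub ys _ _) ⟩
      ∑ xs (λ x → ∑ ys (λ y → π x y * f x y) - ∑ ys (λ y → π x y * g x y))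
        ≈⟨ ∑-sub xs _ _ ⟩
      expect xs ys π f - expect xs ys π g ∎
      where open ≈-Reasoning

    abs-expect : (f : X → Y → Carrier) → (∀ x y → 0# ≤ π x y) →
                 abs (expect xs ys π f) ≤ expect xs ys π (λ x y → abs (f x y))
    abs-expect f 0≤π = ≤-trans (abs-∑ xs _) (∑-mono-≤ xs λ x →
      ≤-trans (abs-∑ ys _) (∑-mono-≤ ys λ y → abs-* (f x y) (0≤π x y)))

    ∑-expect : (as : List A) (f : A → X → Y → Carrier) →
               ∑ as (λ a → expect xs ys π (f a)) ≈ expect xs ys π (λ x y → ∑ as (λ a → f a x y))
    ∑-expect as f = begin
      ∑ as (λ a → ∑ xs λ x → ∑ ys λ y → π x y * f a x y)    ≈⟨ ∑-swap as xs _ ⟩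
      ∑ xs (λ x → ∑ as λ a → ∑ ys λ y → π x y * f a x y)    ≈⟨ (∑-cong xs λ x → ∑-swap as ys _) ⟩
      ∑ xs (λ x → ∑ ys λ y → ∑ as λ a → π x y * f a x y)    ≈⟨ (∑-cong xs λ x → ∑-cong ys λ y → ∑-*ˡ as _ _) ⟩
      ∑ xs (λ x → ∑ ys λ y → π x y * ∑ as λ a → f a x y)    ∎
      where open ≈-Reasoning

    module _ {μ : X → Carrier} {ν : Y → Carrier} (π-couples : Couples xs ys π μ ν) where

      expect-fst : (f : X → Carrier) → expect xs ys π (λ x _ → f x) ≈ ∑ xs (λ x → μ x * f x)
      expect-fst f = ∑-cong xs λ x →
        trans (∑-*ʳ ys (f x) _) (*-congʳ (proj₁ (proj₂ π-couples) x))

      expect-snd : (f : Y → Carrier) → expect xs ys π (λ _ y → f y) ≈ ∑ ys (λ y → ν y * f y)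
      expect-snd f = trans (∑-swap xs ys _) (∑-cong ys λ y →
        trans (∑-*ʳ xs (f y) _) (*-congʳ (proj₂ (proj₂ π-couples) y)))

      expect-const : (k : Carrier) → ∑ xs μ ≈ 1# → expect xs ys π (λ _ _ → k) ≈ k
      expect-const k ∑μ≈1 = begin
        expect xs ys π (λ _ _ → k)  ≈⟨ expect-fst (λ _ → k) ⟩
        ∑ xs (λ x → μ x * k)        ≈⟨ ∑-*ʳ xs k μ ⟩
        ∑ xs μ * k                  ≈⟨ *-congʳ ∑μ≈1 ⟩
        1# * k                      ≈⟨ *-identityˡ k ⟩
        k                           ∎
        where open ≈-Reasoning

  Couples-cong : (xs : List X) (ys : List Y) {π : X → Y → Carrier}
                 {μ μ′ : X → Carrier} {ν ν′ : Y → Carrier} →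
                 (∀ x → μ x ≈ μ′ x) → (∀ y → ν y ≈ ν′ y) →
                 Couples xs ys π μ ν → Couples xs ys π μ′ ν′
  Couples-cong xs ys μ≈μ′ ν≈ν′ (0≤π , fst , snd) =
    0≤π , (λ x → trans (fst x) (μ≈μ′ x)) , (λ y → trans (snd y) (ν≈ν′ y))

  product-couples : (xs : List X) (ys : List Y) {μ : X → Carrier} {ν : Y → Carrier} →
                    (∀ x → 0# ≤ μ x) → (∀ y → 0# ≤ ν y) → ∑ xs μ ≈ 1# → ∑ ys ν ≈ 1# →
                    Couples xs ys (λ x y → μ x * ν y) μ ν
  product-couples xs ys {μ} {ν} 0≤μ 0≤ν ∑μ≈1 ∑ν≈1 =
    (λ x y → *-nonNeg (0≤μ x) (0≤ν y)) ,
    (λ x → trans (∑-*ˡ ys (μ x) ν) (trans (*-congˡ ∑ν≈1) (*-identityʳ _))) ,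
    (λ y → trans (∑-*ʳ xs (ν y) μ) (trans (*-congʳ ∑μ≈1) (*-identityˡ _)))

  module Mixture
    (as : List A) (bs : List B) (κ : A → B → Carrier)
    (xs : List X) (ys : List Y) (π : A → B → X → Y → Carrier)
    where

    mix : X → Y → Carrier
    mix x y = expect as bs κ (λ a b → π a b x y)

    -- The law of total expectation. It carries inequalities that are linear in the coupling from
    -- every `π a b` to `mix`.
    expect-mix : (f : X → Y → Carrier) →
                 expect xs ys mix f ≈ expect as bs κ (λ a b → expect xs ys (π a b) f)
    expect-mix f = begin
      ∑ xs (λ x → ∑ ys λ y → mix x y * f x y)
        ≈⟨ (∑-cong xs λ x → ∑-cong ys λ y → sym (expect-*ʳ as bs _ (f x y))) ⟩
      ∑ xs (λ x → ∑ ys λ y → expect as bs κ (λ a b → π a b x y * f x y))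
        ≈⟨ (∑-cong xs λ x → ∑-expect as bs ys _) ⟩
      ∑ xs (λ x → expect as bs κ (λ a b → ∑ ys λ y → π a b x y * f x y))
        ≈⟨ ∑-expect as bs xs _ ⟩
      expect as bs κ (λ a b → expect xs ys (π a b) f) ∎
      where open ≈-Reasoning

    -- The first marginal of `π a b` depends on `a` alone, so averaging it over `κ` sees only the
    -- marginal `α`; likewise for the second marginal and `β`.
    mix-couples : {α : A → Carrier} {β : B → Carrier}
                  {μ : A → X → Carrier} {ν : B → Y → Carrier} →
                  Couples as bs κ α β → (∀ a b → Couples xs ys (π a b) (μ a) (ν b)) →
                  Couples xs ys mix (λ x → ∑ as (λ a → α a * μ a x)) (λ y → ∑ bs (λ b → β b * ν b y))
    mix-couples κ-couples π-couples =
      (λ x y → expect-nonNeg as bs (proj₁ κ-couples) (λ a b → proj₁ (π-couples a b) x y)) ,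
      (λ x → trans (∑-expect as bs ys _) (trans
        (expect-cong as bs (λ a b → *-congˡ (proj₁ (proj₂ (π-couples a b)) x)))
        (expect-fst as bs κ-couples _))) ,
      (λ y → trans (∑-expect as bs xs _) (trans
        (expect-cong as bs (λ a b → *-congˡ (proj₂ (proj₂ (π-couples a b)) y)))
        (expect-snd as bs κ-couples _)))

  -- Total variation distance

  private
    ½-nonNeg : 0# ≤ (1# + 1#) ⁻¹
    ½-nonNeg = ⁻¹-nonNeg 0<2

    ½*[x+x]≈x : ∀ x → (1# + 1#) ⁻¹ * (x + x) ≈ x
    ½*[x+x]≈x x = begin
      (1# + 1#) ⁻¹ * (x + x)            ≈⟨ *-congˡ (+-cong (*-identityˡ x) (*-identityˡ x)) ⟨
      (1# + 1#) ⁻¹ * (1# * x + 1# * x)  ≈⟨ *-congˡ (distribʳ x 1# 1#) ⟨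
      (1# + 1#) ⁻¹ * ((1# + 1#) * x)    ≈⟨ *-assoc _ _ _ ⟨
      (1# + 1#) ⁻¹ * (1# + 1#) * x      ≈⟨ *-congʳ (trans (*-comm _ _) (*-inverseʳ 2≉0)) ⟩
      1# * x                            ≈⟨ *-identityˡ x ⟩
      x                                 ∎
      where open ≈-Reasoning

  module _ {q : ℕ} where
    private
      Q : List (Fin q)
      Q = allFin q

    dTV-≈ : {μ ν : Fin q → Carrier} → (∀ a → μ a ≈ ν a) → dTV F μ ν ≈ 0#
    dTV-≈ {μ} {ν} μ≈ν = begin
      (1# + 1#) ⁻¹ * ∑ Q (λ a → abs (μ a - ν a))
        ≈⟨ *-congˡ (∑-cong Q λ a → trans (abs-cong (trans (+-congʳ (μ≈ν a)) (-‿inverseʳ _))) abs-0) ⟩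
      (1# + 1#) ⁻¹ * ∑ Q (λ _ → 0#)
        ≈⟨ *-congˡ (∑-0 Q) ⟩
      (1# + 1#) ⁻¹ * 0#
        ≈⟨ zeroʳ _ ⟩
      0# ∎
      where open ≈-Reasoning

    dTV-triangle : (μ ν κ : Fin q → Carrier) → dTV F μ κ ≤ dTV F μ ν + dTV F ν κ
    dTV-triangle μ ν κ = begin
      (1# + 1#) ⁻¹ * ∑ Q (λ a → abs (μ a - κ a))
        ≤⟨ *-monoʳ-≤ ½-nonNeg (∑-mono-≤ Q λ a →
             ≤-trans (≤-reflexive (abs-cong (sym (telescope (μ a) (ν a) (κ a))))) (abs-+ _ _)) ⟩
      (1# + 1#) ⁻¹ * ∑ Q (λ a → abs (μ a - ν a) + abs (ν a - κ a))
        ≈⟨ *-congˡ (∑-+ Q _ _) ⟩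
      (1# + 1#) ⁻¹ * (∑ Q (λ a → abs (μ a - ν a)) + ∑ Q (λ a → abs (ν a - κ a)))
        ≈⟨ distribˡ _ _ _ ⟩
      dTV F μ ν + dTV F ν κ ∎
      where
      open ≤-Reasoning
      telescope : ∀ x y z → (x - y) + (y - z) ≈ x - z
      telescope x y z = trans (sym (+-assoc (x - y) y (- z))) (+-congʳ (x-y+y≈x x y))

    -- Convexity of total variation: under a common `π` the difference of the two averages is one
    -- expectation of differences, and the absolute value moves inside by the triangle inequality.
    dTV-expect : (xs : List X) (ys : List Y) {π : X → Y → Carrier} → (∀ x y → 0# ≤ π x y) →
                 {α β : Fin q → Carrier} {f : X → Fin q → Carrier} {g : Y → Fin q → Carrier} →
                 (∀ a → α a ≈ expect xs ys π (λ x _ → f x a)) →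
                 (∀ a → β a ≈ expect xs ys π (λ _ y → g y a)) →
                 dTV F α β ≤ expect xs ys π (λ x y → dTV F (f x) (g y))
    dTV-expect xs ys {π} 0≤π {α} {β} {f} {g} α≈ β≈ = begin
      (1# + 1#) ⁻¹ * ∑ Q (λ a → abs (α a - β a))
        ≈⟨ *-congˡ (∑-cong Q λ a → abs-cong (trans (+-cong (α≈ a) (-‿cong (β≈ a))) (sym (expect-sub xs ys _ _)))) ⟩
      (1# + 1#) ⁻¹ * ∑ Q (λ a → abs (expect xs ys π (λ x y → f x a - g y a)))
        ≤⟨ *-monoʳ-≤ ½-nonNeg (∑-mono-≤ Q λ a → abs-expect xs ys _ 0≤π) ⟩
      (1# + 1#) ⁻¹ * ∑ Q (λ a → expect xs ys π (λ x y → abs (f x a - g y a)))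
        ≈⟨ *-congˡ (∑-expect xs ys Q _) ⟩
      (1# + 1#) ⁻¹ * expect xs ys π (λ x y → ∑ Q (λ a → abs (f x a - g y a)))
        ≈⟨ expect-*ˡ xs ys _ _ ⟨
      expect xs ys π (λ x y → dTV F (f x) (g y)) ∎
      where open ≤-Reasoning

    -- The optimal coupling of two spin distributions

    module OptimalCoupling
      (α β : Fin q → Carrier)
      (0≤α : ∀ a → 0# ≤ α a) (0≤β : ∀ a → 0# ≤ β a)
      (∑α≈1 : ∑ Q α ≈ 1#) (∑β≈1 : ∑ Q β ≈ 1#)
      where

      private
        m α′ β′ : Fin q → Carrier
        m a = α a ⊓ β a
        α′ a = α a - m a
        β′ a = β a - m a

        d : Carrier
        d = ∑ Q α′

        0≤α′ : ∀ a → 0# ≤ α′ a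
        0≤α′ a = x≤y⇒0≤y-x (x⊓y≤x _ _)

        0≤β′ : ∀ a → 0# ≤ β′ a
        0≤β′ a = x≤y⇒0≤y-x (x⊓y≤y _ _)

        ∑β′≈d : ∑ Q β′ ≈ d
        ∑β′≈d = begin
          ∑ Q β′         ≈⟨ ∑-sub Q β m ⟩
          ∑ Q β - ∑ Q m  ≈⟨ +-congʳ (trans ∑β≈1 (sym ∑α≈1)) ⟩
          ∑ Q α - ∑ Q m  ≈⟨ ∑-sub Q α m ⟨
          d              ∎
          where open ≈-Reasoning

        0≤d : 0# ≤ d
        0≤d = ∑-nonNeg Q 0≤α′

        -- Both excesses have total mass `d`, and at each spin they add up to the absolute
        -- difference by `abs-sub`; halving the sum returns `d`.
        d≈dTV : d ≈ dTV F α β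
        d≈dTV = begin
          d                                           ≈⟨ ½*[x+x]≈x d ⟨
          (1# + 1#) ⁻¹ * (d + d)                      ≈⟨ *-congˡ (+-congˡ ∑β′≈d) ⟨
          (1# + 1#) ⁻¹ * (∑ Q α′ + ∑ Q β′)            ≈⟨ *-congˡ (∑-+ Q α′ β′) ⟨
          (1# + 1#) ⁻¹ * ∑ Q (λ a → α′ a + β′ a)      ≈⟨ *-congˡ (∑-cong Q λ a → abs-sub (α a) (β a)) ⟨
          dTV F α β                                   ∎
          where open ≈-Reasoning

        -- An inverse of d, with value 0 at 0 so that it is nonnegative.
        inverse : ∃[ e ] (0# ≤ e × (∀ x → (d ≈ 0# → x ≈ 0#) → x * (d * e) ≈ x))
        inverse with d ≈? 0#
        ... | yes d≈0 = 0# , ≤-refl , λ x x≈0 →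
          trans (*-congʳ (x≈0 d≈0)) (trans (zeroˡ _) (sym (x≈0 d≈0)))
        ... | no d≉0 = d ⁻¹ , ⁻¹-nonNeg (0≤d , d≉0 ∘ sym) , λ x _ →
          trans (*-congˡ (*-inverseʳ d≉0)) (*-identityʳ x)

        e : Carrier
        e = proj₁ inverse

        0≤e : 0# ≤ e
        0≤e = proj₁ (proj₂ inverse)

        -- When `d` is zero, the nonnegative terms of `α′` sum to zero and so vanish one by one,
        -- which is the side condition of `inverse`.
        α′-cancel : ∀ a → α′ a * (d * e) ≈ α′ a
        α′-cancel a = proj₂ (proj₂ inverse) (α′ a) λ d≈0 → ∑≈0⇒term≈0 0≤α′ d≈0 (∈-allFin a)

        β′-cancel : ∀ b → β′ b * (d * e) ≈ β′ b
        β′-cancel b = proj₂ (proj₂ inverse) (β′ b) λ d≈0 →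
          ∑≈0⇒term≈0 0≤β′ (trans ∑β′≈d d≈0) (∈-allFin b)

        off : Fin q → Fin q → Carrier
        off a b = α′ a * (β′ b * e)

        0≤off : ∀ a b → 0# ≤ off a b
        0≤off a b = *-nonNeg (0≤α′ a) (*-nonNeg (0≤β′ b) 0≤e)

        ∑-off-row : ∀ a → ∑ Q (off a) ≈ α′ a
        ∑-off-row a = begin
          ∑ Q (off a)                    ≈⟨ ∑-*ˡ Q (α′ a) _ ⟩
          α′ a * ∑ Q (λ b → β′ b * e)    ≈⟨ *-congˡ (∑-*ʳ Q e β′) ⟩
          α′ a * (∑ Q β′ * e)            ≈⟨ *-congˡ (*-congʳ ∑β′≈d) ⟩
          α′ a * (d * e)                 ≈⟨ α′-cancel a ⟩
          α′ a                           ∎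
          where open ≈-Reasoning

        ∑-off-column : ∀ b → ∑ Q (λ a → off a b) ≈ β′ b
        ∑-off-column b = begin
          ∑ Q (λ a → off a b)  ≈⟨ ∑-*ʳ Q (β′ b * e) α′ ⟩
          d * (β′ b * e)       ≈⟨ *-assoc d (β′ b) e ⟨
          d * β′ b * e         ≈⟨ *-congʳ (*-comm d (β′ b)) ⟩
          β′ b * d * e         ≈⟨ *-assoc (β′ b) d e ⟩
          β′ b * (d * e)       ≈⟨ β′-cancel b ⟩
          β′ b                 ∎
          where open ≈-Reasoning

      -- The common mass `m` stays on the diagonal. The excesses `α′` and `β′`, of equal mass `d`,
      -- are coupled by their product divided by `d`, with `e` standing for the reciprocal.
      κ : Fin q → Fin q → Carrier
      κ a b = 𝟙 (a Fin.≟ b) * m b + off a b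

      κ-couples : Couples Q Q κ α β
      κ-couples = 0≤κ , row , column
        where
        open ≈-Reasoning
        0≤κ : ∀ a b → 0# ≤ κ a b
        0≤κ a b = +-nonNeg (*-nonNeg (𝟙-nonNeg (a Fin.≟ b)) (⊓-nonNeg (0≤α b) (0≤β b))) (0≤off a b)
        row : ∀ a → ∑ Q (κ a) ≈ α a
        row a = begin
          ∑ Q (κ a)                                        ≈⟨ ∑-+ Q _ _ ⟩
          ∑ Q (λ b → 𝟙 (a Fin.≟ b) * m b) + ∑ Q (off a)    ≈⟨ +-cong (∑-𝟙 a m) (∑-off-row a) ⟩
          m a + α′ a                                       ≈⟨ y+[x-y]≈x (α a) (m a) ⟩
          α a                                              ∎
        column : ∀ b → ∑ Q (λ a → κ a b) ≈ β b
        column b = begin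
          ∑ Q (λ a → κ a b)
            ≈⟨ ∑-+ Q _ _ ⟩
          ∑ Q (λ a → 𝟙 (a Fin.≟ b) * m b) + ∑ Q (λ a → off a b)
            ≈⟨ +-cong (∑-cong Q λ a → *-congʳ (𝟙-cong (a Fin.≟ b) (b Fin.≟ a) ≡.sym ≡.sym)) (∑-off-column b) ⟩
          ∑ Q (λ a → 𝟙 (b Fin.≟ a) * m b) + β′ b
            ≈⟨ +-congʳ (∑-𝟙 b (λ _ → m b)) ⟩
          m b + β′ b
            ≈⟨ y+[x-y]≈x (β b) (m b) ⟩
          β b ∎

      -- The diagonal part never disagrees, so the disagreement is at most the total mass of `off`,
      -- which is `d`.
      κ-≢-mass : expect Q Q κ (λ a b → 𝟙 (¬? (a Fin.≟ b))) ≤ dTV F α β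
      κ-≢-mass = begin
        expect Q Q κ (λ a b → 𝟙 (¬? (a Fin.≟ b)))  ≤⟨ (∑-mono-≤ Q λ a → ∑-mono-≤ Q λ b → off-diagonal a b) ⟩
        ∑ Q (λ a → ∑ Q (off a))                    ≈⟨ ∑-cong Q ∑-off-row ⟩
        d                                          ≈⟨ d≈dTV ⟩
        dTV F α β                                  ∎
        where
        open ≤-Reasoning
        off-diagonal : ∀ a b → κ a b * 𝟙 (¬? (a Fin.≟ b)) ≤ off a b
        off-diagonal a b with a Fin.≟ b
        ... | yes _ = ≤-trans (≤-reflexive (zeroʳ _)) (0≤off a b)
        ... | no _  = ≤-reflexive (trans (*-identityʳ _) (trans (+-congʳ (zeroˡ _)) (+-identityˡ _)))

-- Configurations and partial assignments

private
  variable
    n q : ℕ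
    Λ : Subset n

at-restrict : {Λ : Subset n} (x : Config q n) {v : Fin n} (v∈Λ : v ∈ Λ) → at (restrict Λ x) v∈Λ ≡ lookup x v
at-restrict {Λ = inside ∷ Λ}  (c ∷ x) here        = refl
at-restrict {Λ = inside ∷ Λ}  (c ∷ x) (there v∈Λ) = at-restrict x v∈Λ
at-restrict {Λ = outside ∷ Λ} (c ∷ x) (there v∈Λ) = at-restrict x v∈Λ

restrict≡⇒agree : {Λ : Subset n} {x y : Config q n} → restrict Λ x ≡ restrict Λ y →
                  ∀ {v} → v ∈ Λ → lookup x v ≡ lookup y v
restrict≡⇒agree {x = x} {y} eq v∈Λ =
  ≡.trans (≡.sym (at-restrict x v∈Λ)) (≡.trans (cong (λ σ → at σ v∈Λ) eq) (at-restrict y v∈Λ))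

agree⇒restrict≡ : (Λ : Subset n) (x y : Config q n) →
                  (∀ {v} → v ∈ Λ → lookup x v ≡ lookup y v) → restrict Λ x ≡ restrict Λ y
agree⇒restrict≡ []            []      []      x~y = refl
agree⇒restrict≡ (inside ∷ Λ)  (c ∷ x) (d ∷ y) x~y =
  cong₂ _∷_ (x~y here) (agree⇒restrict≡ Λ x y (x~y ∘ there))
agree⇒restrict≡ (outside ∷ Λ) (c ∷ x) (d ∷ y) x~y =
  cong free (agree⇒restrict≡ Λ x y (x~y ∘ there))

restrict-⊆ : {Λ Λ′ : Subset n} {x y : Config q n} → Λ ⊆ Λ′ → restrict Λ′ x ≡ restrict Λ′ y →
             restrict Λ x ≡ restrict Λ y
restrict-⊆ Λ⊆Λ′ eq = agree⇒restrict≡ _ _ _ (λ v∈Λ → restrict≡⇒agree eq (Λ⊆Λ′ v∈Λ))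

extend : {Λ : Subset n} → Fin q → Assignment q Λ → Config q n
extend c []       = []
extend c (d ∷ σ)  = d ∷ extend c σ
extend c (free σ) = c ∷ extend c σ

restrict-extend : (c : Fin q) (σ : Assignment q Λ) → restrict Λ (extend c σ) ≡ σ
restrict-extend c []       = refl
restrict-extend c (d ∷ σ)  = cong (d ∷_) (restrict-extend c σ)
restrict-extend c (free σ) = cong free (restrict-extend c σ)

∈-allConfigs : (x : Config q n) → x ∈ˡ allConfigs q n
∈-allConfigs []      = here refl
∈-allConfigs (c ∷ x) = ∈-cartesianProductWith⁺ _∷_ (∈-allFin c) (∈-allConfigs x)

∈-allAssignments : (σ : Assignment q Λ) → σ ∈ˡ allAssignments q Λ
∈-allAssignments []       = here refl
∈-allAssignments (c ∷ σ)  = ∈-cartesianProductWith⁺ _∷_ (∈-allFin c) (∈-allAssignments σ)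
∈-allAssignments (free σ) = ∈-map⁺ free (∈-allAssignments σ)

∈-disagreement⇒≢ : (Λ : Subset n) (x y : Config q n) {v : Fin n} →
                   v ∈ disagreement (restrict Λ x) (restrict Λ y) → lookup x v ≢ lookup y v
∈-disagreement⇒≢ (inside ∷ Λ) (c ∷ x) (d ∷ y) v∈D with c Fin.≟ d
∈-disagreement⇒≢ (inside ∷ Λ) (c ∷ x) (d ∷ y) here        | no c≢d = c≢d
∈-disagreement⇒≢ (inside ∷ Λ) (c ∷ x) (d ∷ y) (there v∈D) | no _   = ∈-disagreement⇒≢ Λ x y v∈D
∈-disagreement⇒≢ (inside ∷ Λ) (c ∷ x) (d ∷ y) (there v∈D) | yes _  = ∈-disagreement⇒≢ Λ x y v∈D
∈-disagreement⇒≢ (outside ∷ Λ) (c ∷ x) (d ∷ y) (there v∈D) = ∈-disagreement⇒≢ Λ x y v∈D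

-- Supplies the filler spin for `extend`, since `Fin q` is not known to be inhabited. A disagreement
-- forces a pinned vertex; the spin of `σ` at the first pinned vertex is returned, whether or not
-- the disagreement lies there.
spin-of-disagreement : (σ τ : Assignment q Λ) → DifferAtExactlyOne σ τ → Fin q
spin-of-disagreement []       []       ()
spin-of-disagreement (c ∷ σ)  (d ∷ τ)  _      = c
spin-of-disagreement (free σ) (free τ) differ = spin-of-disagreement σ τ differ

-- Sums over coordinates and conditional factors

module ConfigSums {c ℓ₁ ℓ₂ : Level} (F : OrderedField c ℓ₁ ℓ₂) where
  open OrderedField F hiding (zero)
  open OrderedFieldProperties F

  -- Evaluates the contribution of the pinned vertices to the expected Hamming distance; for
  -- boundary conditions with one disagreement it is 1.
  fromℕ-∣disagreement∣ : (Λ : Subset n) (x y : Config q n) →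
    ∑ (allFin n) (λ v → 𝟙 ((v ∈? Λ) ×-dec ¬? (lookup x v Fin.≟ lookup y v)))
    ≈ fromℕ ∣ disagreement (restrict Λ x) (restrict Λ y) ∣
  fromℕ-∣disagreement∣ [] [] [] = ≈-refl
  -- The splitting equation is abstracted together with `c Fin.≟ d`, so that the comparison in its
  -- head term reduces in the same case split.
  fromℕ-∣disagreement∣ {suc n} (inside ∷ Λ) (c ∷ x) (d ∷ y) with c Fin.≟ d | ∑-allFin-suc n (λ v → 𝟙 ((v ∈? (inside ∷ Λ)) ×-dec ¬? (lookup (c ∷ x) v Fin.≟ lookup (d ∷ y) v)))
  ... | no _  | split = trans split (+-congˡ (fromℕ-∣disagreement∣ Λ x y))
  ... | yes _ | split = trans split (trans (+-identityˡ _) (fromℕ-∣disagreement∣ Λ x y))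
  fromℕ-∣disagreement∣ {suc n} (outside ∷ Λ) (c ∷ x) (d ∷ y) =
    trans (∑-allFin-suc n _) (trans (+-identityˡ _) (fromℕ-∣disagreement∣ Λ x y))

  -- Interpolates from `x` to `y` one coordinate at a time. A coordinate `w` where they differ costs
  -- at most `r w` and one where they agree costs nothing; the triangle inequality adds the costs.
  -- The induction fixes the head first, through the hybrid `d ∷ x`.
  path-≤ : (D : Config q n → Config q n → Carrier) (r : Fin n → Carrier) →
           (∀ x → D x x ≤ 0#) → (∀ x y z → D x z ≤ D x y + D y z) →
           (∀ w x y → (∀ v → v ≢ w → lookup x v ≡ lookup y v) → D x y ≤ r w) →
           ∀ x y → D x y ≤ ∑ (allFin n) (λ w → 𝟙 (¬? (lookup x w Fin.≟ lookup y w)) * r w)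
  path-≤ D r D-self triangle single [] [] = D-self []
  path-≤ {n = suc n} D r D-self triangle single (c ∷ x) (d ∷ y) = begin
    D (c ∷ x) (d ∷ y)
      ≤⟨ triangle _ (d ∷ x) _ ⟩
    D (c ∷ x) (d ∷ x) + D (d ∷ x) (d ∷ y)
      ≤⟨ +-mono-≤ first rest ⟩
    𝟙 (¬? (c Fin.≟ d)) * r zero
      + ∑ (allFin n) (λ w → 𝟙 (¬? (lookup x w Fin.≟ lookup y w)) * r (suc w))
      ≈⟨ ∑-allFin-suc n _ ⟨
    ∑ (allFin (suc n)) (λ w → 𝟙 (¬? (lookup (c ∷ x) w Fin.≟ lookup (d ∷ y) w)) * r w) ∎
    where
    open ≤-Reasoning
    first : D (c ∷ x) (d ∷ x) ≤ 𝟙 (¬? (c Fin.≟ d)) * r zero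
    first with c Fin.≟ d
    ... | yes refl = ≤-trans (D-self _) (≤-reflexive (sym (zeroˡ _)))
    ... | no _     = ≤-trans
      (single zero _ _ λ { zero 0≢0 → contradiction refl 0≢0 ; (suc _) _ → refl })
      (≤-reflexive (sym (*-identityˡ _)))
    rest : D (d ∷ x) (d ∷ y) ≤ ∑ (allFin n) (λ w → 𝟙 (¬? (lookup x w Fin.≟ lookup y w)) * r (suc w))
    rest = path-≤ (λ x y → D (d ∷ x) (d ∷ y)) (r ∘ suc)
      (λ x → D-self (d ∷ x)) (λ x y z → triangle (d ∷ x) (d ∷ y) (d ∷ z))
      (λ w x y x~y → single (suc w) (d ∷ x) (d ∷ y)
        λ { zero _ → refl ; (suc v) sv≢sw → x~y v (sv≢sw ∘ cong suc) })
      x y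

  factor-cong : {A : Set p} (d : Dec A) {f g : A → Carrier} → (∀ a → f a ≈ g a) →
                factor d f ≈ factor d g
  factor-cong (yes a) f≈g = f≈g a
  factor-cong (no _)  f≈g = ≈-refl

  factor-nonNeg : {A : Set p} (d : Dec A) {f : A → Carrier} → (∀ a → 0# ≤ f a) → 0# ≤ factor d f
  factor-nonNeg (yes a) 0≤f = 0≤f a
  factor-nonNeg (no _)  0≤f = 0≤1

  -- The part of `A` outside `B` may carry another value `k′`. In the application that part consists
  -- of factors already determined by the larger pinned set, with `k′` read off the boundary
  -- condition.
  factor-split : {A : Set p} {B : Set p′} (d : Dec A) (e : Dec B) {k k′ : Carrier} →
                 (B → A) → (A → ¬ B → k ≈ k′) →
                 factor d (λ _ → k) ≈ factor (d ×-dec ¬? e) (λ _ → k′) * factor e (λ _ → k)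
  factor-split (yes a) (yes b) B⇒A k≈k′ = sym (*-identityˡ _)
  factor-split (yes a) (no ¬b) B⇒A k≈k′ = trans (k≈k′ a ¬b) (sym (*-identityʳ _))
  factor-split (no ¬a) (yes b) B⇒A k≈k′ = contradiction (B⇒A b) ¬a
  factor-split (no ¬a) (no ¬b) B⇒A k≈k′ = sym (*-identityʳ _)

-- Factorisation of the conditional weights

module Gibbs {c ℓ₁ ℓ₂ : Level} (F : OrderedField c ℓ₁ ℓ₂) {n q : ℕ}
  (S : SpinSystem F n q) (permissive : Permissive F S) where

  open OrderedField F hiding (zero)
  open OrderedFieldProperties F
  open ConfigSums F
  open SpinSystem S
  open Graph graph using (Adj; adj?) renaming (sym to adj-sym)
  open CommutativeSemigroupProperties *-commutativeSemigroup using (interchange)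

  V : List (Fin n)
  V = allFin n

  Q : List (Fin q)
  Q = allFin q

  Ω : List (Config q n)
  Ω = allConfigs q n

  private
    touches? : (Λ : Subset n) (u v : Fin n) → Dec (u Fin.< v × Adj u v × ¬ (u ∈ Λ × v ∈ Λ))
    touches? Λ u v = (u Fin.<? v) ×-dec adj? u v ×-dec ¬? ((u ∈? Λ) ×-dec (v ∈? Λ))

    module _ (Λ : Subset n) (x : Config q n) where
      vertexFactor : Fin n → Carrier
      vertexFactor v = factor (¬? (v ∈? Λ)) λ _ → A_V (lookup x v)

      edgeFactor : (u v : Fin n) → Carrier
      edgeFactor u v = factor (touches? Λ u v) λ _ → A_E (lookup x u) (lookup x v)

      -- The weight of `x` under the boundary condition given by `x` itself. Crossing and inner
      -- edges merge into one product over the edges not contained in `Λ`, a family that shrinks as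
      -- `Λ` grows.
      freeWeight : Carrier
      freeWeight = ∏ V vertexFactor * ∏ V (λ u → ∏ V (edgeFactor u))

      outward inner : (u v : Fin n) → Carrier
      outward u v = factor (adj? u v ×-dec ¬? (u ∈? Λ) ×-dec (v ∈? Λ)) λ _ →
        A_E (lookup x u) (lookup x v)
      inner u v =
        factor ((u Fin.<? v) ×-dec adj? u v ×-dec ¬? (u ∈? Λ) ×-dec ¬? (v ∈? Λ)) λ _ →
          A_E (lookup x u) (lookup x v)

      -- A crossing edge is listed with its free endpoint first, in either numerical order; this
      -- sorts by order. For `u` equal to `v` all factors are 1, as no vertex is both free and
      -- pinned.
      outward-oriented : ∀ u v →
        outward u v ≈ factor (u Fin.<? v) (λ _ → outward u v) * factor (v Fin.<? u) (λ _ → outward u v)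
      outward-oriented u v with u Fin.<? v | v Fin.<? u
      ... | yes u<v | yes v<u = contradiction v<u (Fin.<-asym u<v)
      ... | yes _   | no _    = sym (*-identityʳ _)
      ... | no _    | yes _   = sym (*-identityˡ _)
      ... | no u≮v  | no v≮u with Fin.<-cmp u v
      ...   | tri< u<v _ _ = contradiction u<v u≮v
      ...   | tri> _ _ v<u = contradiction v<u v≮u
      ...   | tri≈ _ refl _ with adj? u u | u ∈? Λ
      ...     | yes _ | yes _ = sym (*-identityˡ _)
      ...     | yes _ | no _  = sym (*-identityˡ _)
      ...     | no _  | _     = sym (*-identityˡ _)

      edge-cases : ∀ u v →
        factor (u Fin.<? v) (λ _ → outward u v) * factor (u Fin.<? v) (λ _ → outward v u) * inner u v
        ≈ edgeFactor u v
      edge-cases u v with u Fin.<? v | adj? u v | adj? v u | u ∈? Λ | v ∈? Λ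
      ... | no _  | _      | _      | _     | _     = trans (*-identityʳ _) (*-identityʳ _)
      ... | yes _ | no _   | no _   | _     | _     = trans (*-identityʳ _) (*-identityʳ _)
      ... | yes _ | yes uv | no ¬vu | _     | _     = contradiction (adj-sym uv) ¬vu
      ... | yes _ | no ¬uv | yes vu | _     | _     = contradiction (adj-sym vu) ¬uv
      ... | yes _ | yes _  | yes _  | yes _ | yes _ = trans (*-identityʳ _) (*-identityʳ _)
      -- The free endpoint is the larger vertex `v`, so the crossing factor has its arguments
      -- reversed.
      ... | yes _ | yes _  | yes _  | yes _ | no _  =
        trans (*-identityʳ _) (trans (*-identityˡ _) (A_E-sym _ _))
      ... | yes _ | yes _  | yes _  | no _  | yes _ = trans (*-identityʳ _) (*-identityʳ _)
      ... | yes _ | yes _  | yes _  | no _  | no _  = trans (*-congʳ (*-identityʳ _)) (*-identityˡ _)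

      -- Exchanging the two products reindexes the crossing edges whose free endpoint is the larger
      -- one. Then every edge sits at its pair `u < v`, and `edge-cases` compares factor by factor.
      ∏-edges : ∏ V (λ u → ∏ V (outward u)) * ∏ V (λ u → ∏ V (inner u))
                ≈ ∏ V (λ u → ∏ V (edgeFactor u))
      ∏-edges = begin
        ∏∏ outward * ∏∏ inner
          ≈⟨ *-congʳ (∏∏-cong outward-oriented) ⟩
        ∏∏ (λ u v → up u v * down u v) * ∏∏ inner
          ≈⟨ *-congʳ (∏∏-* up down) ⟩
        ∏∏ up * ∏∏ down * ∏∏ inner
          ≈⟨ *-congʳ (*-congˡ (∏-swap V V down)) ⟩
        ∏∏ up * ∏∏ (λ u v → down v u) * ∏∏ inner
          ≈⟨ *-congʳ (∏∏-* up (λ u v → down v u)) ⟨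
        ∏∏ (λ u v → up u v * down v u) * ∏∏ inner
          ≈⟨ ∏∏-* (λ u v → up u v * down v u) inner ⟨
        ∏∏ (λ u v → up u v * down v u * inner u v)
          ≈⟨ ∏∏-cong edge-cases ⟩
        ∏∏ edgeFactor ∎
        where
        open ≈-Reasoning
        ∏∏ : (Fin n → Fin n → Carrier) → Carrier
        ∏∏ f = ∏ V (λ u → ∏ V (f u))
        ∏∏-cong : {f g : Fin n → Fin n → Carrier} → (∀ u v → f u v ≈ g u v) → ∏∏ f ≈ ∏∏ g
        ∏∏-cong f≈g = ∏-cong V λ u → ∏-cong V (f≈g u)
        ∏∏-* : (f g : Fin n → Fin n → Carrier) → ∏∏ (λ u v → f u v * g u v) ≈ ∏∏ f * ∏∏ g
        ∏∏-* f g = trans (∏-cong V λ u → ∏-* V (f u) (g u)) (∏-* V _ _)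
        up down : Fin n → Fin n → Carrier
        up   u v = factor (u Fin.<? v) (λ _ → outward u v)
        down u v = factor (v Fin.<? u) (λ _ → outward u v)

    weight≈freeWeight : ∀ Λ {η x} → restrict Λ x ≡ restrict Λ η →
                        weight F S (restrict Λ η) x ≈ freeWeight Λ x
    weight≈freeWeight Λ {η} {x} x~η = begin
      𝟙 (restrict Λ x ≟ restrict Λ η) * ∏ V (vertexFactor Λ x)
        * ∏ V (λ u → ∏ V λ v →
            factor (adj? u v ×-dec ¬? (u ∈? Λ) ×-dec (v ∈? Λ)) λ (_ , _ , v∈Λ) →
              A_E (lookup x u) (at (restrict Λ η) v∈Λ))
        * ∏ V (λ u → ∏ V (inner Λ x u))
        ≈⟨ *-congʳ (*-cong
             (trans (*-congʳ (𝟙-true (restrict Λ x ≟ restrict Λ η) x~η)) (*-identityˡ _))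
             (∏-cong V λ u → ∏-cong V λ v → factor-cong (adj? u v ×-dec ¬? (u ∈? Λ) ×-dec (v ∈? Λ))
               λ (_ , _ , v∈Λ) → reflexive (cong (A_E (lookup x u))
                 (≡.trans (at-restrict η v∈Λ) (≡.sym (restrict≡⇒agree x~η v∈Λ)))))) ⟩
      ∏ V (vertexFactor Λ x) * ∏ V (λ u → ∏ V (outward Λ x u)) * ∏ V (λ u → ∏ V (inner Λ x u))
        ≈⟨ *-assoc _ _ _ ⟩
      ∏ V (vertexFactor Λ x) * (∏ V (λ u → ∏ V (outward Λ x u)) * ∏ V (λ u → ∏ V (inner Λ x u)))
        ≈⟨ *-congˡ (∏-edges Λ x) ⟩
      freeWeight Λ x ∎
      where open ≈-Reasoning

    -- The factors present for `Λ` but not for `Λ′` belong to vertices of `Λ′` or to edges inside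
    -- `Λ′`. On configurations that agree with `η` on `Λ′` they are constant, and `k` is their
    -- product.
    freeWeight-split : ∀ {Λ Λ′} → Λ ⊆ Λ′ → ∀ η → ∃[ k ] (∀ x → restrict Λ′ x ≡ restrict Λ′ η →
                       freeWeight Λ x ≈ k * freeWeight Λ′ x)
    freeWeight-split {Λ} {Λ′} Λ⊆Λ′ η = ∏ V kᵛ * ∏ V (λ u → ∏ V (kᵉ u)) , λ x x~η → begin
      ∏ V (vertexFactor Λ x) * ∏ V (λ u → ∏ V (edgeFactor Λ x u))
        ≈⟨ *-cong
             (∏-cong V λ v → factor-split (¬? (v ∈? Λ)) (¬? (v ∈? Λ′))
               (λ v∉Λ′ → v∉Λ′ ∘ Λ⊆Λ′)
               (λ _ ¬v∉Λ′ → reflexive (cong A_V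
                 (restrict≡⇒agree x~η (decidable-stable (v ∈? Λ′) ¬v∉Λ′)))))
             (∏-cong V λ u → ∏-cong V λ v → factor-split (touches? Λ u v) (touches? Λ′ u v)
               (λ (u<v , uv , ¬both) → u<v , uv , λ (u∈Λ , v∈Λ) → ¬both (Λ⊆Λ′ u∈Λ , Λ⊆Λ′ v∈Λ))
               (λ (u<v , uv , _) ¬touches →
                 let (u∈Λ′ , v∈Λ′) = decidable-stable ((u ∈? Λ′) ×-dec (v ∈? Λ′))
                                       (λ ¬both → ¬touches (u<v , uv , ¬both))
                 in reflexive (cong₂ A_E (restrict≡⇒agree x~η u∈Λ′) (restrict≡⇒agree x~η v∈Λ′)))) ⟩
      ∏ V (λ v → kᵛ v * vertexFactor Λ′ x v) * ∏ V (λ u → ∏ V (λ v → kᵉ u v * edgeFactor Λ′ x u v))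
        ≈⟨ *-cong (∏-* V _ _) (trans (∏-cong V λ u → ∏-* V _ _) (∏-* V _ _)) ⟩
      ∏ V kᵛ * ∏ V (vertexFactor Λ′ x)
        * (∏ V (λ u → ∏ V (kᵉ u)) * ∏ V (λ u → ∏ V (edgeFactor Λ′ x u)))
        ≈⟨ interchange _ _ _ _ ⟩
      ∏ V kᵛ * ∏ V (λ u → ∏ V (kᵉ u)) * freeWeight Λ′ x ∎
      where
      open ≈-Reasoning
      kᵛ : Fin n → Carrier
      kᵛ v = factor (¬? (v ∈? Λ) ×-dec ¬? (¬? (v ∈? Λ′))) λ _ → A_V (lookup η v)
      kᵉ : Fin n → Fin n → Carrier
      kᵉ u v = factor (touches? Λ u v ×-dec ¬? (touches? Λ′ u v)) λ _ → A_E (lookup η u) (lookup η v)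

  -- Conditional Gibbs distributions and their consistency

  weight-nonNeg : ∀ {Λ} (σ : Assignment q Λ) x → 0# ≤ weight F S σ x
  weight-nonNeg {Λ} σ x = *-nonNeg (*-nonNeg (*-nonNeg
    (𝟙-nonNeg (restrict Λ x ≟ σ))
    (∏-nonNeg V λ v → factor-nonNeg (¬? (v ∈? Λ)) λ _ → A_V-nonNeg _))
    (∏-nonNeg V λ u → ∏-nonNeg V λ v →
      factor-nonNeg (adj? u v ×-dec ¬? (u ∈? Λ) ×-dec (v ∈? Λ)) λ _ → A_E-nonNeg _ _))
    (∏-nonNeg V λ u → ∏-nonNeg V λ v →
      factor-nonNeg ((u Fin.<? v) ×-dec adj? u v ×-dec ¬? (u ∈? Λ) ×-dec ¬? (v ∈? Λ)) λ _ → A_E-nonNeg _ _)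

  -- The boundary condition η is a full configuration, of which only the
  -- restriction to Λ matters.
  γ : Subset n → Config q n → Config q n → Carrier
  γ Λ η = μ F S (restrict Λ η)

  γ-nonNeg : ∀ Λ η x → 0# ≤ γ Λ η x
  γ-nonNeg Λ η x = *-nonNeg (weight-nonNeg (restrict Λ η) x) (⁻¹-nonNeg (permissive Λ (restrict Λ η)))

  Z*Z⁻¹≈1 : ∀ Λ η → Z F S (restrict Λ η) * Z F S (restrict Λ η) ⁻¹ ≈ 1#
  Z*Z⁻¹≈1 Λ η = *-inverseʳ (proj₂ (permissive Λ (restrict Λ η)) ∘ sym)

  ∑-γ : ∀ Λ η → ∑ Ω (γ Λ η) ≈ 1#
  ∑-γ Λ η = trans (∑-*ʳ Ω _ _) (Z*Z⁻¹≈1 Λ η)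

  γ-support : ∀ Λ {η x} → restrict Λ x ≢ restrict Λ η → γ Λ η x ≈ 0#
  γ-support Λ {η} {x} x≁η = begin
    𝟙 (restrict Λ x ≟ restrict Λ η) * _ * _ * _ * _  ≈⟨ *-congʳ (*-congʳ (*-congʳ (*-congʳ (𝟙-false (restrict Λ x ≟ restrict Λ η) x≁η)))) ⟩
    0# * _ * _ * _ * _                               ≈⟨ *-congʳ (*-congʳ (*-congʳ (zeroˡ _))) ⟩
    0# * _ * _ * _                                   ≈⟨ *-congʳ (*-congʳ (zeroˡ _)) ⟩
    0# * _ * _                                       ≈⟨ *-congʳ (zeroˡ _) ⟩
    0# * _                                           ≈⟨ zeroˡ _ ⟩
    0#                                               ∎
    where open ≈-Reasoning

  γ-cong : ∀ Λ {η ζ} x → restrict Λ η ≡ restrict Λ ζ → γ Λ η x ≈ γ Λ ζ x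
  γ-cong Λ x η~ζ = reflexive (cong (λ σ → μ F S σ x) η~ζ)

  -- The Markov property without division by a probability: both densities are normalised
  -- `freeWeight`s, which `freeWeight-split` makes proportional. The constant may be zero, when the
  -- pinning has probability zero under `γ Λ η`.
  γ-proportional : ∀ {Λ Λ′} → Λ ⊆ Λ′ → ∀ η → ∃[ k ] (∀ x → restrict Λ′ x ≡ restrict Λ′ η →
                   γ Λ η x ≈ k * γ Λ′ η x)
  γ-proportional {Λ} {Λ′} Λ⊆Λ′ η with freeWeight-split Λ⊆Λ′ η
  ... | k , split = k * z⁻¹ * z′ , λ x x~η → begin
    weight F S (restrict Λ η) x * z⁻¹
      ≈⟨ *-congʳ (weight≈freeWeight Λ (restrict-⊆ Λ⊆Λ′ x~η)) ⟩
    freeWeight Λ x * z⁻¹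
      ≈⟨ *-congʳ (split x x~η) ⟩
    k * freeWeight Λ′ x * z⁻¹
      ≈⟨ *-congʳ (*-congˡ (weight≈freeWeight Λ′ x~η)) ⟨
    k * w′ x * z⁻¹
      ≈⟨ trans (*-assoc _ _ _) (trans (*-congˡ (*-comm _ _)) (sym (*-assoc _ _ _))) ⟩
    k * z⁻¹ * w′ x
      ≈⟨ *-congˡ (trans (sym (*-identityʳ _)) (*-congˡ (sym (Z*Z⁻¹≈1 Λ′ η)))) ⟩
    k * z⁻¹ * (w′ x * (z′ * z′ ⁻¹))
      ≈⟨ *-congˡ (trans (sym (*-assoc _ _ _)) (trans (*-congʳ (*-comm _ _)) (*-assoc _ _ _))) ⟩
    k * z⁻¹ * (z′ * (w′ x * z′ ⁻¹))
      ≈⟨ *-assoc _ _ _ ⟨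
    k * z⁻¹ * z′ * γ Λ′ η x ∎
    where
    open ≈-Reasoning
    z⁻¹ z′ : Carrier
    z⁻¹ = Z F S (restrict Λ η) ⁻¹
    z′  = Z F S (restrict Λ′ η)
    w′ : Config q n → Carrier
    w′ = weight F S (restrict Λ′ η)

  -- Case analysis on a sum keeps the goal, where the decision procedure itself
  -- occurs inside the weights, unchanged.
  agree? : ∀ Λ (x y : Config q n) → restrict Λ x ≡ restrict Λ y ⊎ restrict Λ x ≢ restrict Λ y
  agree? Λ x y = toSum (restrict Λ x ≟ restrict Λ y)

  -- Resampling outside `Λ′` preserves `γ Λ η`. Only those `x` that agree with `y` on `Λ′`
  -- contribute; for them the first factor is `k * γ Λ′ y x` and the second is `γ Λ′ y y`, so the
  -- sum is `k * γ Λ′ y y`. If `y` violates the boundary condition, both sides vanish.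
  γ-consistent : ∀ {Λ Λ′} → Λ ⊆ Λ′ → ∀ η y → ∑ Ω (λ x → γ Λ η x * γ Λ′ x y) ≈ γ Λ η y
  γ-consistent {Λ} {Λ′} Λ⊆Λ′ η y with agree? Λ y η
  ... | inj₂ y≁η = begin
    ∑ Ω (λ x → γ Λ η x * γ Λ′ x y)  ≈⟨ ∑-cong Ω vanish ⟩
    ∑ Ω (λ _ → 0#)                  ≈⟨ ∑-0 Ω ⟩
    0#                              ≈⟨ γ-support Λ y≁η ⟨
    γ Λ η y                         ∎
    where
    open ≈-Reasoning
    vanish : ∀ x → γ Λ η x * γ Λ′ x y ≈ 0#
    vanish x with agree? Λ′ y x
    ... | inj₂ y≁x  = trans (*-congˡ (γ-support Λ′ y≁x)) (zeroʳ _)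
    ... | inj₁ y~x = trans (*-congʳ (γ-support Λ (λ x~η → y≁η (≡.trans (restrict-⊆ Λ⊆Λ′ y~x) x~η)))) (zeroˡ _)
  ... | inj₁ y~η = begin
    ∑ Ω (λ x → γ Λ η x * γ Λ′ x y)          ≈⟨ ∑-cong Ω factorise ⟩
    ∑ Ω (λ x → k * γ Λ′ y x * γ Λ′ y y)     ≈⟨ ∑-*ʳ Ω (γ Λ′ y y) _ ⟩
    ∑ Ω (λ x → k * γ Λ′ y x) * γ Λ′ y y     ≈⟨ *-congʳ (∑-*ˡ Ω k _) ⟩
    k * ∑ Ω (γ Λ′ y) * γ Λ′ y y             ≈⟨ *-congʳ (trans (*-congˡ (∑-γ Λ′ y)) (*-identityʳ k)) ⟩
    k * γ Λ′ y y                            ≈⟨ proportional y refl ⟨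
    γ Λ y y                                 ≈⟨ γ-cong Λ y y~η ⟩
    γ Λ η y                                 ∎
    where
    open ≈-Reasoning
    k : Carrier
    k = proj₁ (γ-proportional Λ⊆Λ′ y)
    proportional : ∀ x → restrict Λ′ x ≡ restrict Λ′ y → γ Λ y x ≈ k * γ Λ′ y x
    proportional = proj₂ (γ-proportional Λ⊆Λ′ y)
    factorise : ∀ x → γ Λ η x * γ Λ′ x y ≈ k * γ Λ′ y x * γ Λ′ y y
    factorise x with agree? Λ′ x y
    ... | inj₁ x~y = *-cong (trans (γ-cong Λ x (≡.sym y~η)) (proportional x x~y)) (γ-cong Λ′ y x~y)
    ... | inj₂ x≁y  = begin
      γ Λ η x * γ Λ′ x y           ≈⟨ *-congˡ (γ-support Λ′ (x≁y ∘ ≡.sym)) ⟩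
      γ Λ η x * 0#                 ≈⟨ zeroʳ _ ⟩
      0#                           ≈⟨ zeroˡ _ ⟨
      0# * γ Λ′ y y                ≈⟨ *-congʳ (trans (*-congˡ (γ-support Λ′ x≁y)) (zeroʳ k)) ⟨
      k * γ Λ′ y x * γ Λ′ y y      ∎

-- Single-site marginals and the influence matrix

module Dobrushin {c ℓ₁ ℓ₂ : Level} (F : OrderedField c ℓ₁ ℓ₂) {n q : ℕ}
  (S : SpinSystem F n q) (permissive : Permissive F S) where

  open OrderedField F hiding (zero)
  open OrderedFieldProperties F
  open CouplingProperties F
  open ConfigSums F
  open Gibbs F S permissive

  γ-marginal : Subset n → Config q n → Fin n → Fin q → Carrier
  γ-marginal Λ η = marginal F S (restrict Λ η)

  ∑-γ-marginal : ∀ Λ η v → ∑ Q (γ-marginal Λ η v) ≈ 1#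
  ∑-γ-marginal Λ η v = begin
    ∑ Q (λ a → ∑ Ω λ x → 𝟙 (lookup x v Fin.≟ a) * γ Λ η x)  ≈⟨ ∑-swap Q Ω _ ⟩
    ∑ Ω (λ x → ∑ Q λ a → 𝟙 (lookup x v Fin.≟ a) * γ Λ η x)  ≈⟨ (∑-cong Ω λ x → ∑-𝟙 (lookup x v) (λ _ → γ Λ η x)) ⟩
    ∑ Ω (γ Λ η)                                             ≈⟨ ∑-γ Λ η ⟩
    1#                                                      ∎
    where open ≈-Reasoning

  γ-marginal-nonNeg : ∀ Λ η v a → 0# ≤ γ-marginal Λ η v a
  γ-marginal-nonNeg Λ η v a = ∑-nonNeg Ω λ x → *-nonNeg (𝟙-nonNeg (lookup x v Fin.≟ a)) (γ-nonNeg Λ η x)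

  -- With `Λ′` the complement of `v`, the marginal at `v` becomes an average of the single-site
  -- conditional laws that `ρ` compares.
  γ-marginal-consistent : ∀ {Λ Λ′} → Λ ⊆ Λ′ → ∀ η v a →
    γ-marginal Λ η v a ≈ ∑ Ω (λ x → γ Λ η x * γ-marginal Λ′ x v a)
  γ-marginal-consistent {Λ} {Λ′} Λ⊆Λ′ η v a = begin
    ∑ Ω (λ y → 𝟙 (lookup y v Fin.≟ a) * γ Λ η y)
      ≈⟨ (∑-cong Ω λ y → *-congˡ (sym (γ-consistent Λ⊆Λ′ η y))) ⟩
    ∑ Ω (λ y → 𝟙 (lookup y v Fin.≟ a) * ∑ Ω λ x → γ Λ η x * γ Λ′ x y)
      ≈⟨ (∑-cong Ω λ y → sym (∑-*ˡ Ω _ _)) ⟩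
    ∑ Ω (λ y → ∑ Ω λ x → 𝟙 (lookup y v Fin.≟ a) * (γ Λ η x * γ Λ′ x y))
      ≈⟨ ∑-swap Ω Ω _ ⟩
    ∑ Ω (λ x → ∑ Ω λ y → 𝟙 (lookup y v Fin.≟ a) * (γ Λ η x * γ Λ′ x y))
      ≈⟨ (∑-cong Ω λ x → ∑-cong Ω λ y → x∙yz≈y∙xz _ _ _) ⟩
    ∑ Ω (λ x → ∑ Ω λ y → γ Λ η x * (𝟙 (lookup y v Fin.≟ a) * γ Λ′ x y))
      ≈⟨ (∑-cong Ω λ x → ∑-*ˡ Ω _ _) ⟩
    ∑ Ω (λ x → γ Λ η x * γ-marginal Λ′ x v a) ∎
    where
    open ≈-Reasoning
    open CommutativeSemigroupProperties *-commutativeSemigroup using (x∙yz≈y∙xz)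

  -- Total probability over the spin at `v`. Once the marginal is expanded over `y`, the updated `η`
  -- agrees with `y` on the enlarged pinned set for every `y` in the support, which leaves
  -- `γ-consistent`. Permissiveness gives the pinned distributions a meaning even for spins of
  -- marginal zero.
  γ-pin : ∀ Λ η v x →
    ∑ Q (λ a → γ-marginal Λ η v a * γ (Λ ∪ ⁅ v ⁆) (η [ v ]≔ a) x) ≈ γ Λ η x
  γ-pin Λ η v x = begin
    ∑ Q (λ a → (∑ Ω λ y → 𝟙 (lookup y v Fin.≟ a) * γ Λ η y) * γ Λ⁺ (η [ v ]≔ a) x)
      ≈⟨ (∑-cong Q λ a → sym (∑-*ʳ Ω _ _)) ⟩
    ∑ Q (λ a → ∑ Ω λ y → 𝟙 (lookup y v Fin.≟ a) * γ Λ η y * γ Λ⁺ (η [ v ]≔ a) x)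
      ≈⟨ ∑-swap Q Ω _ ⟩
    ∑ Ω (λ y → ∑ Q λ a → 𝟙 (lookup y v Fin.≟ a) * γ Λ η y * γ Λ⁺ (η [ v ]≔ a) x)
      ≈⟨ (∑-cong Ω λ y → trans (∑-cong Q λ a → *-assoc _ _ _) (∑-𝟙 (lookup y v) _)) ⟩
    ∑ Ω (λ y → γ Λ η y * γ Λ⁺ (η [ v ]≔ lookup y v) x)
      ≈⟨ ∑-cong Ω pinned ⟩
    ∑ Ω (λ y → γ Λ η y * γ Λ⁺ y x)
      ≈⟨ γ-consistent (p⊆p∪q ⁅ v ⁆) η x ⟩
    γ Λ η x ∎
    where
    open ≈-Reasoning
    Λ⁺ : Subset n
    Λ⁺ = Λ ∪ ⁅ v ⁆
    pinned : ∀ y → γ Λ η y * γ Λ⁺ (η [ v ]≔ lookup y v) x ≈ γ Λ η y * γ Λ⁺ y x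
    pinned y with agree? Λ y η
    ... | inj₂ y≁η = trans (*-congʳ (γ-support Λ y≁η)) (trans (zeroˡ _)
                       (sym (trans (*-congʳ (γ-support Λ y≁η)) (zeroˡ _))))
    ... | inj₁ y~η = *-congˡ (γ-cong Λ⁺ x (agree⇒restrict≡ Λ⁺ _ _ agree))
      where
      agree : ∀ {w} → w ∈ Λ⁺ → lookup (η [ v ]≔ lookup y v) w ≡ lookup y w
      agree {w} w∈Λ⁺ with w Fin.≟ v
      ... | yes refl = lookup∘update v η (lookup y v)
      ... | no w≢v with x∈p∪q⁻ Λ ⁅ v ⁆ w∈Λ⁺
      ...   | inj₁ w∈Λ = ≡.trans (lookup∘update′ w≢v η _) (≡.sym (restrict≡⇒agree y~η w∈Λ))
      ...   | inj₂ w∈v = contradiction (x∈⁅y⁆⇒x≡y v w∈v) w≢v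

  ρ-nonNeg : ∀ w v → 0# ≤ ρ F S w v
  ρ-nonNeg w v = maximum-nonNeg
    (filter (λ (σ , τ) → differAtMostAt? w σ τ)
      (cartesianProduct (allAssignments q (∁ ⁅ v ⁆)) (allAssignments q (∁ ⁅ v ⁆))))
    λ (σ , τ) → dTV F (marginal F S σ v) (marginal F S τ v)

  dTV≤ρ : ∀ v w x y → (∀ u → u ≢ w → lookup x u ≡ lookup y u) →
          dTV F (γ-marginal (∁ ⁅ v ⁆) x v) (γ-marginal (∁ ⁅ v ⁆) y v) ≤ ρ F S w v
  dTV≤ρ v w x y x~y = term≤maximum _ (∈-filter⁺ (λ (σ , τ) → differAtMostAt? w σ τ)
    (∈-cartesianProduct⁺ (∈-allAssignments _) (∈-allAssignments _)) differ)
    where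
    differ : DifferAtMostAt w (restrict (∁ ⁅ v ⁆) x) (restrict (∁ ⁅ v ⁆) y)
    differ {u} u∈D with u Fin.≟ w
    ... | yes refl = x∈⁅x⁆ u
    ... | no u≢w   = contradiction (x~y u u≢w) (∈-disagreement⇒≢ (∁ ⁅ v ⁆) x y u∈D)

  -- Interpolation between `x` and `y`, with the distance of the conditional laws at `v` as the
  -- pseudometric and `ρ` as the cost of one change.
  dTV≤∑ρ : ∀ v x y →
    dTV F (γ-marginal (∁ ⁅ v ⁆) x v) (γ-marginal (∁ ⁅ v ⁆) y v)
    ≤ ∑ V (λ w → 𝟙 (¬? (lookup x w Fin.≟ lookup y w)) * ρ F S w v)
  dTV≤∑ρ v = path-≤ (λ x y → dTV F (m x) (m y)) (λ w → ρ F S w v)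
    (λ x → ≤-reflexive (dTV-≈ {μ = m x} λ _ → ≈-refl)) (λ x y z → dTV-triangle (m x) (m y) (m z)) (dTV≤ρ v)
    where
    m : Config q n → Fin q → Carrier
    m x = γ-marginal (∁ ⁅ v ⁆) x v

  -- Disagreement probabilities under a coupling

  disagree : (Config q n → Config q n → Carrier) → Fin n → Carrier
  disagree π w = expect Ω Ω π (λ x y → 𝟙 (¬? (lookup x w Fin.≟ lookup y w)))

  disagree-nonNeg : ∀ {π} → (∀ x y → 0# ≤ π x y) → ∀ w → 0# ≤ disagree π w
  disagree-nonNeg 0≤π w = expect-nonNeg Ω Ω 0≤π λ x y → 𝟙-nonNeg (¬? (lookup x w Fin.≟ lookup y w))

  module _ {Λ : Subset n} {η ζ : Config q n} {π : Config q n → Config q n → Carrier}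
    (π-couples : Couples Ω Ω π (γ Λ η) (γ Λ ζ)) where
    private
      0≤π : ∀ x y → 0# ≤ π x y
      0≤π = proj₁ π-couples

    -- A row or column of `π` whose sum vanishes has only zero entries, by nonnegativity, and
    -- configurations violating the boundary condition have mass zero.
    coupling-support : ∀ x y → π x y ≈ 0# ⊎ (restrict Λ x ≡ restrict Λ η × restrict Λ y ≡ restrict Λ ζ)
    coupling-support x y with agree? Λ x η | agree? Λ y ζ
    ... | inj₁ x~η | inj₁ y~ζ = inj₂ (x~η , y~ζ)
    ... | inj₂ x≁η | _        = inj₁ (∑≈0⇒term≈0 (λ y → 0≤π x y)
      (trans (proj₁ (proj₂ π-couples) x) (γ-support Λ x≁η)) (∈-allConfigs y))
    ... | inj₁ _   | inj₂ y≁ζ = inj₁ (∑≈0⇒term≈0 (λ x → 0≤π x y)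
      (trans (proj₂ (proj₂ π-couples) y) (γ-support Λ y≁ζ)) (∈-allConfigs x))

    -- On the support of `π` both spins at a pinned vertex are those of the boundary conditions, so
    -- disagreement there is deterministic.
    disagree-fixed : ∀ {w} → w ∈ Λ → disagree π w ≤ 𝟙 (¬? (lookup η w Fin.≟ lookup ζ w))
    disagree-fixed {w} w∈Λ = begin
      disagree π w                                                   ≤⟨ expect-mono-≤ Ω Ω on-support ⟩
      expect Ω Ω π (λ _ _ → 𝟙 (¬? (lookup η w Fin.≟ lookup ζ w)))    ≈⟨ expect-const Ω Ω π-couples _ (∑-γ Λ η) ⟩
      𝟙 (¬? (lookup η w Fin.≟ lookup ζ w))                           ∎
      where
      open ≤-Reasoning
      on-support : ∀ x y → π x y * 𝟙 (¬? (lookup x w Fin.≟ lookup y w))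
                           ≤ π x y * 𝟙 (¬? (lookup η w Fin.≟ lookup ζ w))
      on-support x y with coupling-support x y
      ... | inj₁ π≈0 = ≤-reflexive (trans (*-congʳ π≈0) (trans (zeroˡ _)
                         (sym (trans (*-congʳ π≈0) (zeroˡ _)))))
      ... | inj₂ (x~η , y~ζ) = *-monoʳ-≤ (0≤π x y)
        (𝟙-mono (¬? (lookup x w Fin.≟ lookup y w)) (¬? (lookup η w Fin.≟ lookup ζ w)) λ x≢y η≡ζ →
          x≢y (≡.trans (restrict≡⇒agree x~η w∈Λ) (≡.trans η≡ζ (≡.sym (restrict≡⇒agree y~ζ w∈Λ)))))

    -- Both marginals are averages, under the same `π`, of conditional laws given all other spins.
    -- Convexity reduces the distance to pairs `(x , y)`, where `dTV≤∑ρ` applies, and linearity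
    -- turns its indicators into disagreement probabilities.
    dTV-marginal≤ : ∀ {v} → v ∉ Λ →
      dTV F (γ-marginal Λ η v) (γ-marginal Λ ζ v) ≤ ∑ V (λ w → disagree π w * ρ F S w v)
    dTV-marginal≤ {v} v∉Λ = begin
      dTV F (γ-marginal Λ η v) (γ-marginal Λ ζ v)
        ≤⟨ dTV-expect Ω Ω 0≤π
             (λ a → trans (γ-marginal-consistent Λ⊆ η v a) (sym (expect-fst Ω Ω π-couples _)))
             (λ a → trans (γ-marginal-consistent Λ⊆ ζ v a) (sym (expect-snd Ω Ω π-couples _))) ⟩
      expect Ω Ω π (λ x y → dTV F (γ-marginal (∁ ⁅ v ⁆) x v) (γ-marginal (∁ ⁅ v ⁆) y v))
        ≤⟨ expect-mono-≤ Ω Ω (λ x y → *-monoʳ-≤ (0≤π x y) (dTV≤∑ρ v x y)) ⟩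
      expect Ω Ω π (λ x y → ∑ V (λ w → 𝟙 (¬? (lookup x w Fin.≟ lookup y w)) * ρ F S w v))
        ≈⟨ ∑-expect Ω Ω V _ ⟨
      ∑ V (λ w → expect Ω Ω π (λ x y → 𝟙 (¬? (lookup x w Fin.≟ lookup y w)) * ρ F S w v))
        ≈⟨ (∑-cong V λ w → expect-*ʳ Ω Ω _ (ρ F S w v)) ⟩
      ∑ V (λ w → disagree π w * ρ F S w v) ∎
      where
      open ≤-Reasoning
      Λ⊆ : Λ ⊆ ∁ ⁅ v ⁆
      Λ⊆ {u} u∈Λ = x∉p⇒x∈∁p λ u∈v → v∉Λ (subst (_∈ Λ) (x∈⁅y⁆⇒x≡y v u∈v) u∈Λ)

  -- Building a coupling that satisfies (*) by pinning

  Subinvariant : Subset n → (Config q n → Config q n → Carrier) → Set ℓ₂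
  Subinvariant Λ π = ∀ w → w ∉ Λ → disagree π w ≤ ∑ V (λ u → disagree π u * ρ F S u w)

  module _ (Λ : Subset n) (η ζ : Config q n) {v : Fin n} (v∉Λ : v ∉ Λ)
    (pinned : ∀ a b → ∃[ π ] (Couples Ω Ω π (γ (Λ ∪ ⁅ v ⁆) (η [ v ]≔ a)) (γ (Λ ∪ ⁅ v ⁆) (ζ [ v ]≔ b))
                             × Subinvariant (Λ ∪ ⁅ v ⁆) π)) where
    private
      module O = OptimalCoupling (γ-marginal Λ η v) (γ-marginal Λ ζ v)
        (γ-marginal-nonNeg Λ η v) (γ-marginal-nonNeg Λ ζ v) (∑-γ-marginal Λ η v) (∑-γ-marginal Λ ζ v)

      πᵖ : Fin q → Fin q → Config q n → Config q n → Carrier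
      πᵖ a b = proj₁ (pinned a b)

      open Mixture Q Q O.κ Ω Ω πᵖ

      mix-couples-γ : Couples Ω Ω mix (γ Λ η) (γ Λ ζ)
      mix-couples-γ = Couples-cong Ω Ω (γ-pin Λ η v) (γ-pin Λ ζ v)
        (mix-couples O.κ-couples (λ a b → proj₁ (proj₂ (pinned a b))))

      0≤κ : ∀ a b → 0# ≤ O.κ a b
      0≤κ = proj₁ O.κ-couples

      mix-subinvariant : Subinvariant Λ mix
      mix-subinvariant w w∉Λ with w Fin.≟ v
      ... | yes refl = begin
        disagree mix w
          ≈⟨ expect-mix _ ⟩
        expect Q Q O.κ (λ a b → disagree (πᵖ a b) w)
          -- Under `πᵖ a b` the vertex is pinned to `a` on one side and to `b` on the other, so it
          -- disagrees exactly when `a` and `b` differ.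
          ≤⟨ expect-mono-≤ Q Q (λ a b → *-monoʳ-≤ (0≤κ a b) (≤-trans
               (disagree-fixed (proj₁ (proj₂ (pinned a b))) (q⊆p∪q Λ ⁅ v ⁆ (x∈⁅x⁆ v)))
               (≤-reflexive (reflexive (cong₂ (λ a b → 𝟙 (¬? (a Fin.≟ b)))
                 (lookup∘update v η a) (lookup∘update v ζ b)))))) ⟩
        expect Q Q O.κ (λ a b → 𝟙 (¬? (a Fin.≟ b)))
          ≤⟨ O.κ-≢-mass ⟩
        dTV F (γ-marginal Λ η v) (γ-marginal Λ ζ v)
          -- The bound for arbitrary couplings is applied to `mix` itself, so its own disagreement
          -- probabilities appear on the right.
          ≤⟨ dTV-marginal≤ mix-couples-γ v∉Λ ⟩
        ∑ V (λ u → disagree mix u * ρ F S u w) ∎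
        where open ≤-Reasoning
      ... | no w≢v = begin
        disagree mix w
          ≈⟨ expect-mix _ ⟩
        expect Q Q O.κ (λ a b → disagree (πᵖ a b) w)
          ≤⟨ expect-mono-≤ Q Q (λ a b → *-monoʳ-≤ (0≤κ a b) (proj₂ (proj₂ (pinned a b)) w w∉Λ⁺)) ⟩
        expect Q Q O.κ (λ a b → ∑ V (λ u → disagree (πᵖ a b) u * ρ F S u w))
          ≈⟨ ∑-expect Q Q V _ ⟨
        ∑ V (λ u → expect Q Q O.κ (λ a b → disagree (πᵖ a b) u * ρ F S u w))
          ≈⟨ (∑-cong V λ u → trans (expect-*ʳ Q Q _ _) (*-congʳ (sym (expect-mix _)))) ⟩
        ∑ V (λ u → disagree mix u * ρ F S u w) ∎
        where
        open ≤-Reasoning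
        w∉Λ⁺ : w ∉ Λ ∪ ⁅ v ⁆
        w∉Λ⁺ w∈Λ⁺ with x∈p∪q⁻ Λ ⁅ v ⁆ w∈Λ⁺
        ... | inj₁ w∈Λ = w∉Λ w∈Λ
        ... | inj₂ w∈v = w≢v (x∈⁅y⁆⇒x≡y v w∈v)

    unpin : ∃[ π ] (Couples Ω Ω π (γ Λ η) (γ Λ ζ) × Subinvariant Λ π)
    unpin = mix , mix-couples-γ , mix-subinvariant

  -- Induction on a list `L` covering the free vertices: its head is either pinned already or is
  -- pinned now. The boundary conditions stay general, because pinning may create new disagreements.
  subinvariant-coupling : (L : List (Fin n)) (Λ : Subset n) → (∀ v → v ∉ Λ → v ∈ˡ L) → ∀ η ζ →
                          ∃[ π ] (Couples Ω Ω π (γ Λ η) (γ Λ ζ) × Subinvariant Λ π)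
  -- No vertex is free, so the inequality is vacuous and the independent coupling serves.
  subinvariant-coupling [] Λ free⊆L η ζ =
    (λ x y → γ Λ η x * γ Λ ζ y) ,
    product-couples Ω Ω (γ-nonNeg Λ η) (γ-nonNeg Λ ζ) (∑-γ Λ η) (∑-γ Λ ζ) ,
    λ w w∉Λ → contradiction (free⊆L w w∉Λ) λ ()
  subinvariant-coupling (v ∷ L) Λ free⊆L η ζ with v ∈? Λ
  ... | yes v∈Λ = subinvariant-coupling L Λ free⊆L′ η ζ
    where
    free⊆L′ : ∀ w → w ∉ Λ → w ∈ˡ L
    free⊆L′ w w∉Λ with free⊆L w w∉Λ
    ... | here refl = contradiction v∈Λ w∉Λ
    ... | there w∈L = w∈L
  ... | no v∉Λ = unpin Λ η ζ v∉Λ λ a b →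
    subinvariant-coupling L (Λ ∪ ⁅ v ⁆) free⊆L′ (η [ v ]≔ a) (ζ [ v ]≔ b)
    where
    free⊆L′ : ∀ w → w ∉ Λ ∪ ⁅ v ⁆ → w ∈ˡ L
    free⊆L′ w w∉Λ⁺ with free⊆L w (w∉Λ⁺ ∘ p⊆p∪q ⁅ v ⁆)
    ... | here refl = contradiction (q⊆p∪q Λ ⁅ v ⁆ (x∈⁅x⁆ v)) w∉Λ⁺
    ... | there w∈L = w∈L

  -- Summing (*) and the bound on the expected distance

  expectedHamming≈∑disagree : ∀ π → expectedHamming F π ≈ ∑ V (disagree π)
  expectedHamming≈∑disagree π = begin
    expectedHamming F π
      ≈⟨ expect-cong Ω Ω (λ x y → *-congˡ
           (fromℕ-length-filter (λ v → ¬? (lookup x v Fin.≟ lookup y v)) V)) ⟩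
    expect Ω Ω π (λ x y → ∑ V (λ w → 𝟙 (¬? (lookup x w Fin.≟ lookup y w))))
      ≈⟨ ∑-expect Ω Ω V _ ⟨
    ∑ V (disagree π) ∎
    where open ≈-Reasoning

  module _ {δ : Carrier} (0<δ : 0# < δ) (contraction : DobrushinShlosman F S δ)
    {Λ : Subset n} {η ζ : Config q n} {π : Config q n → Config q n → Carrier}
    (π-couples : Couples Ω Ω π (γ Λ η) (γ Λ ζ)) (π-subinvariant : Subinvariant Λ π)
    (one : DifferAtExactlyOne (restrict Λ η) (restrict Λ ζ)) where
    private
      0≤disagree : ∀ w → 0# ≤ disagree π w
      0≤disagree = disagree-nonNeg (proj₁ π-couples)

      s : Carrier
      s = ∑ V (disagree π)

      -- Gives pinned and free vertices one common bound: a free vertex has indicator 0, and at a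
      -- pinned vertex the nonnegative sum is added.
      pointwise : ∀ w → disagree π w ≤ 𝟙 ((w ∈? Λ) ×-dec ¬? (lookup η w Fin.≟ lookup ζ w))
                                       + ∑ V (λ u → disagree π u * ρ F S u w)
      pointwise w with w ∈? Λ
      ... | no w∉Λ  = ≤-trans (π-subinvariant w w∉Λ) (≤-reflexive (sym (+-identityˡ _)))
      ... | yes w∈Λ = ≤-trans (disagree-fixed π-couples w∈Λ)
        (x≤x+y (∑-nonNeg V λ u → *-nonNeg (0≤disagree u) (ρ-nonNeg u w)))

      s≤1+s[1-δ] : s ≤ 1# + s * (1# - δ)
      s≤1+s[1-δ] = begin
        s
          ≤⟨ ∑-mono-≤ V pointwise ⟩
        ∑ V (λ w → 𝟙 ((w ∈? Λ) ×-dec ¬? (lookup η w Fin.≟ lookup ζ w))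
                   + ∑ V (λ u → disagree π u * ρ F S u w))
          ≈⟨ ∑-+ V _ _ ⟩
        ∑ V (λ w → 𝟙 ((w ∈? Λ) ×-dec ¬? (lookup η w Fin.≟ lookup ζ w)))
          + ∑ V (λ w → ∑ V (λ u → disagree π u * ρ F S u w))
          ≈⟨ +-cong
               (trans (fromℕ-∣disagreement∣ Λ η ζ) (trans (reflexive (cong fromℕ one)) (+-identityʳ 1#)))
               (trans (∑-swap V V _) (∑-cong V λ u → ∑-*ˡ V _ _)) ⟩
        1# + ∑ V (λ u → disagree π u * ∑ V (ρ F S u))
          -- After the exchange of sums each disagreement probability multiplies a full row sum of
          -- `ρ`, which the Dobrushin-Shlosman condition bounds.
          ≤⟨ +-monoʳ-≤ 1# (∑-mono-≤ V λ u → *-monoʳ-≤ (0≤disagree u)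
               (≤-trans (term≤maximum _ (∈-allFin u)) contraction)) ⟩
        1# + ∑ V (λ u → disagree π u * (1# - δ))
          ≈⟨ +-congˡ (∑-*ʳ V _ _) ⟩
        1# + s * (1# - δ) ∎
        where open ≤-Reasoning

      sδ≤1 : s * δ ≤ 1#
      sδ≤1 = begin
        s * δ                       ≈⟨ y+[x-y]≈x (s * δ) s ⟨
        -- Adding `s * δ - s` to both sides of the recursive bound cancels every `s` on the right
        -- and leaves 1.
        s + (s * δ - s)             ≤⟨ +-monoˡ-≤ _ s≤1+s[1-δ] ⟩
        1# + s * (1# - δ) + (s * δ - s)
          ≈⟨ +-congʳ (+-congˡ (trans (x[y-z]≈xy-xz s 1# δ) (+-congʳ (*-identityʳ s)))) ⟩
        1# + (s - s * δ) + (s * δ - s)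
          ≈⟨ +-assoc _ _ _ ⟩
        1# + ((s - s * δ) + (s * δ - s))
          ≈⟨ +-congˡ (trans (sym (+-assoc _ _ _)) (trans (+-congʳ (x-y+y≈x s (s * δ))) (-‿inverseʳ s))) ⟩
        1# + 0#
          ≈⟨ +-identityʳ 1# ⟩
        1# ∎
        where
        open ≤-Reasoning
        open RingProperties ring using (x[y-z]≈xy-xz)

    ∑disagree≤δ⁻¹ : s ≤ δ ⁻¹
    ∑disagree≤δ⁻¹ = begin
      s                 ≈⟨ *-identityʳ s ⟨
      s * 1#            ≈⟨ *-congˡ (*-inverseʳ (proj₂ 0<δ ∘ sym)) ⟨
      s * (δ * δ ⁻¹)    ≈⟨ *-assoc s δ (δ ⁻¹) ⟨
      s * δ * δ ⁻¹      ≤⟨ *-monoˡ-≤ (⁻¹-nonNeg 0<δ) sδ≤1 ⟩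
      1# * δ ⁻¹         ≈⟨ *-identityˡ (δ ⁻¹) ⟩
      δ ⁻¹              ∎
      where open ≤-Reasoning

  -- The constructed coupling has expected distance at most `δ ⁻¹`; the factor `fromℕ k` is at least
  -- 1 and only enlarges the bound. Extending `σ` and `τ` by a filler spin passes to full boundary
  -- configurations.
  coupling-independent : ∀ {δ k} → 0# < δ → 1 ℕ.≤ k → DobrushinShlosman F S δ →
                         CouplingIndependent F S (fromℕ k * δ ⁻¹)
  coupling-independent {δ} {k} 0<δ 1≤k contraction Λ σ τ one =
    π , Couples-cong Ω Ω (γ-extend σ) (γ-extend τ) π-couples , (begin
      expectedHamming F π  ≈⟨ expectedHamming≈∑disagree π ⟩
      ∑ V (disagree π)     ≤⟨ ∑disagree≤δ⁻¹ 0<δ contraction π-couples π-subinvariant one′ ⟩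
      δ ⁻¹                 ≈⟨ *-identityˡ (δ ⁻¹) ⟨
      1# * δ ⁻¹            ≤⟨ *-monoˡ-≤ (⁻¹-nonNeg 0<δ) (1≤fromℕ 1≤k) ⟩
      fromℕ k * δ ⁻¹       ∎)
    where
    open ≤-Reasoning
    spin : Fin q
    spin = spin-of-disagreement σ τ one
    η ζ : Config q n
    η = extend spin σ
    ζ = extend spin τ
    γ-extend : ∀ (σ : Assignment q Λ) x → γ Λ (extend spin σ) x ≈ μ F S σ x
    γ-extend σ x = reflexive (cong (λ σ → μ F S σ x) (restrict-extend spin σ))
    one′ : DifferAtExactlyOne (restrict Λ η) (restrict Λ ζ)
    one′ = ≡.trans (cong₂ (λ σ τ → ∣ disagreement σ τ ∣) (restrict-extend spin σ) (restrict-extend spin τ)) one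
    existence : ∃[ π ] (Couples Ω Ω π (γ Λ η) (γ Λ ζ) × Subinvariant Λ π)
    existence = subinvariant-coupling V Λ (λ v _ → ∈-allFin v) η ζ
    π : Config q n → Config q n → Carrier
    π = proj₁ existence
    π-couples : Couples Ω Ω π (γ Λ η) (γ Λ ζ)
    π-couples = proj₁ (proj₂ existence)
    π-subinvariant : Subinvariant Λ π
    π-subinvariant = proj₂ (proj₂ existence)

theorem5p7 : ∀ {c ℓ₁ ℓ₂ : Level} (F : OrderedField c ℓ₁ ℓ₂) → let open OrderedField F in
    (n q Δ : ℕ) (S : SpinSystem F n q) (δ : Carrier) → 0# < δ → δ < 1# →
    Permissive F S →
    Graph.maxDegree (SpinSystem.graph S) ≡ Δ → 1 ℕ.≤ Δ →
    DobrushinShlosman F S δ →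
    CouplingIndependent F S (fromℕ Δ * δ ⁻¹)
theorem5p7 F n q Δ S δ 0<δ _ permissive _ 1≤Δ = Dobrushin.coupling-independent F S permissive 0<δ 1≤Δ
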